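{- Let $B(x,y)\in\mathbb{Z}[x][[y]]$ be the unique formal power series satisfying $B=1+xyB^2\bigl(xB^2-(x-1)(B-1)\bigr)$, and let $b_n^{(m)}:=[x^ny^m]B(x,y)$ for nonnegative integers $n,m$. For all positive integers $n$ and $m$, the number of $(102,000)$-avoiding inversion sequences $e$ of length $n$ with $\operatorname{dist}(e)=m$ equals $$b_{n+1}^{(m)}+\sum_{k=1}^{n}\sum_{\ell=0}^{m}b_k^{(\ell)}\,b_{n-k}^{(m-\ell)}.$$
   Context: An inversion sequence of length $n$ is an integer sequence $e=(e_1,\dots,e_n)$ with $0\le e_j\le j-1$ for all $j$. It is $(102,000)$-avoiding if there are no indices $i<j<k$ with $e_j<e_i<e_k$ (pattern $102$) and no indices $i<j<k$ with $e_i=e_j=e_k$ (pattern $000$). $\operatorname{dist}(e)$ is the number of distinct entries of $e$. $[x^ny^m]F$ denotes the coefficient of $x^ny^m$ in $F$. -}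

module Defs where

open import Data.Nat as ℕ using (ℕ; zero; suc; _∸_)
open import Data.Integer as ℤ using (ℤ; +_; 0ℤ; 1ℤ; _+_; _-_; _*_)
open import Data.Fin as Fin using (Fin)
open import Data.Fin.Properties using (any?)
open import Data.Vec as Vec using (Vec; []; _∷ʳ_; lookup; toList)
open import Data.List as List using (List; []; _∷_; upTo; map; concatMap; filter; length; deduplicate; foldr)
open import Data.Product using (∃; Σ; _×_; _,_)
open import Relation.Nullary using (¬_; Dec; _×-dec_; ¬?)

-- Bivariate formal power series over ℤ, represented by coefficients:
-- F n m = [x^n y^m] F.

Series : Set
Series = ℕ → ℕ → ℤ

∑< : ℕ → (ℕ → ℤ) → ℤ
∑< n f = foldr _+_ 0ℤ (map f (upTo n))

∑≤ : ℕ → (ℕ → ℤ) → ℤ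
∑≤ n f = ∑< (suc n) f

_⊕_ : Series → Series → Series
(F ⊕ G) n m = F n m + G n m

_⊖_ : Series → Series → Series
(F ⊖ G) n m = F n m - G n m

_⊗_ : Series → Series → Series
(F ⊗ G) n m = ∑≤ n λ i → ∑≤ m λ j → F i j * G (n ∸ i) (m ∸ j)

𝟙 : Series
𝟙 zero zero = 1ℤ
𝟙 _    _    = 0ℤ

𝕩 : Series
𝕩 1 zero = 1ℤ
𝕩 _ _    = 0ℤ

𝕪 : Series
𝕪 zero 1 = 1ℤ
𝕪 _ _    = 0ℤ

SatisfiesB : Series → Set
SatisfiesB B = ∀ n m → B n m ≡′
  ((𝟙 ⊕ (𝕩 ⊗ (𝕪 ⊗ ((B ⊗ B) ⊗ ((𝕩 ⊗ (B ⊗ B)) ⊖ ((𝕩 ⊖ 𝟙) ⊗ (B ⊖ 𝟙))))))) n m)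
  where open import Relation.Binary.PropositionalEquality renaming (_≡_ to _≡′_)

-- Inversion sequences.  A sequence e = (e_1,…,e_n) is a Vec ℕ n; the
-- entry e_{i+1} is  lookup e i  for i : Fin n (0-based positions).

invSeqs : (n : ℕ) → List (Vec ℕ n)
invSeqs zero    = [] ∷ []
invSeqs (suc n) = concatMap (λ e → map (λ v → e ∷ʳ v) (upTo (suc n))) (invSeqs n)

Contains102 : ∀ {n} → Vec ℕ n → Set
Contains102 {n} e = ∃ λ (i : Fin n) → ∃ λ (j : Fin n) → ∃ λ (k : Fin n) →
  (i Fin.< j × j Fin.< k) × (lookup e j ℕ.< lookup e i × lookup e i ℕ.< lookup e k)

Contains000 : ∀ {n} → Vec ℕ n → Set
Contains000 {n} e = ∃ λ (i : Fin n) → ∃ λ (j : Fin n) → ∃ λ (k : Fin n) →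
  (i Fin.< j × j Fin.< k) × (lookup e i ≡′ lookup e j × lookup e j ≡′ lookup e k)
  where open import Relation.Binary.PropositionalEquality renaming (_≡_ to _≡′_)

Avoids102-000 : ∀ {n} → Vec ℕ n → Set
Avoids102-000 e = ¬ Contains102 e × ¬ Contains000 e

contains102? : ∀ {n} (e : Vec ℕ n) → Dec (Contains102 e)
contains102? e = any? λ i → any? λ j → any? λ k →
  (i Fin.<? j ×-dec j Fin.<? k) ×-dec (lookup e j ℕ.<? lookup e i ×-dec lookup e i ℕ.<? lookup e k)

contains000? : ∀ {n} (e : Vec ℕ n) → Dec (Contains000 e)
contains000? e = any? λ i → any? λ j → any? λ k →
  (i Fin.<? j ×-dec j Fin.<? k) ×-dec (lookup e i ℕ.≟ lookup e j ×-dec lookup e j ℕ.≟ lookup e k)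

avoids? : ∀ {n} (e : Vec ℕ n) → Dec (Avoids102-000 e)
avoids? e = ¬? (contains102? e) ×-dec ¬? (contains000? e)

dist : ∀ {n} → Vec ℕ n → ℕ
dist e = length (deduplicate ℕ._≟_ (toList e))

count : ℕ → ℕ → ℕ
count n m = length (filter (λ e → avoids? e ×-dec (dist e ℕ.≟ m)) (invSeqs n))

module Submission where

-- Build an inversion sequence by inserting its values 0, 1, 2, … in increasing order.  Avoiding 102
-- means that each value is inserted into the initial weakly increasing run of the word built so far,
-- and the bound e_j ≤ j − 1 means that, when v is inserted, the first v letters of that run are final.
-- Hence only the number d of remaining letters of the run matters: it becomes d − 1 if v is not used,
-- any of 0, …, d if v is used once and, if v is used twice, any of 1, …, d + 1, or d′ < d in d − d′ ways.
-- The construction stops when d would become −1.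
--
-- The generating functions H_d of the completions from d thus satisfy a linear recurrence with constant
-- coefficients, and z = 1 − 1/B is a root of its kernel that is divisible by x.  The corresponding left
-- eigenvector turns the recurrence into x²yB²H_0 − (B − 1) = z^N · (…) for every N, so that
-- x²yB²H_0 = B − 1 and x H_0 = xB² − (x − 1)(B − 1) by the equation of B.  Comparing coefficients gives
-- the theorem.

open import Defs
open import Level using (Level; _⊔_)
open import Algebra.Bundles using (CommutativeRing)
open import Algebra.Solver.Ring.AlmostCommutativeRing
  using (AlmostCommutativeRing; fromCommutativeRing; _-Raw-AlmostCommutative⟶_)
import Algebra.Solver.Ring
open import Data.Nat as ℕ using (ℕ; zero; suc; _∸_; _<_; _≤_; _≥_; _<?_; _≤?_; _≟_; z≤n; s≤s; z<s)
open import Data.Nat.Properties as ℕ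
  using ( ≤-refl; ≤-trans; ≤-antisym; ≤-pred; ≤∧≢⇒<; ≤⇒≯; ≮⇒≥; <-irrefl; <-trans; <-≤-trans; <⇒≤; <⇒≢; <⇒≱
        ; n<1+n; m<n⇒m<1+n; 1+n≢0; suc-injective; m≤m+n; m+[n∸m]≡n)
open import Data.Integer as ℤ using (ℤ; +_; 0ℤ; 1ℤ)
import Data.Integer.Properties as ℤ
open import Data.Integer.Tactic.RingSolver using (solve-∀)
open import Data.Fin as Fin using (zero; suc)
open import Data.Vec as Vec using (Vec; []; _∷_; toList; fromList; lookup)
import Data.Vec.Properties as Vecₚ
open import Data.List
  using ( List; []; _∷_; _∷ʳ_; _++_; [_]; length; map; foldr; concatMap; filter; reverse; replicate; upTo
        ; cartesianProductWith; deduplicate; initLast; _∷ʳ′_)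
open import Data.List.Properties
  using ( map-upTo; length-++; length-map; length-reverse; filter-++; filter-accept; filter-reject; filter-all
        ; ∷-injective; ∷-injectiveʳ; ∷ʳ-injective; ∷ʳ-injectiveˡ; ∷ʳ-injectiveʳ; ++-identityʳ
        ; unfold-reverse; reverse-involutive)
open import Data.List.Membership.Propositional using (_∈_; _∉_)
open import Data.List.Membership.Propositional.Properties
  using ( ∈-++⁺ˡ; ∈-++⁺ʳ; ∈-++⁻; ∈-map⁺; ∈-map⁻; ∈-filter⁺; ∈-filter⁻; ∈-deduplicate⁺; ∈-deduplicate⁻
        ; ∈-cartesianProductWith⁺; ∈-cartesianProductWith⁻; ∈-upTo⁺; ∈-upTo⁻)
open import Data.List.Membership.Propositional.Properties.WithK using (unique∧set⇒bag)
open import Data.List.Relation.Unary.Any using (here; there)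
open import Data.List.Relation.Unary.All as All using (All; []; _∷_)
import Data.List.Relation.Unary.All.Properties as Allₚ
open import Data.List.Relation.Unary.Unique.Propositional using (Unique; []; _∷_)
import Data.List.Relation.Unary.Unique.Propositional.Properties as Unique
open import Data.List.Relation.Unary.Unique.DecPropositional.Properties using (deduplicate-!)
open import Data.List.Relation.Binary.BagAndSetEquality using (∼bag⇒↭)
open import Data.List.Relation.Binary.Permutation.Propositional.Properties using (↭-length)
open import Data.List.Relation.Binary.Sublist.Propositional
  using (_⊆_; []; _∷_; ⊆-refl; ⊆-trans; from∈; minimum) renaming (_∷ʳ_ to _skip_)
open import Data.List.Relation.Binary.Sublist.Propositional.Properties
  using (filter⁺; filter-⊆; ++⁺; All-resp-⊆; length-mono-≤)
open import Data.Maybe as Maybe using (Maybe)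
open import Data.Product using (∃; _×_; _,_; proj₁; proj₂)
open import Data.Sum using (_⊎_; inj₁; inj₂; [_,_]′)
open import Data.Unit using (⊤; tt)
open import Data.Empty using (⊥)
open import Function using (_∘_; _⟨_⟩_; mk⇔)
open import Relation.Nullary using (¬_; yes; no; contradiction; _×-dec_)
open import Relation.Nullary.Decidable using (dec⇒maybe)
open import Relation.Binary.PropositionalEquality as ≡
  using (_≡_; _≢_; refl; sym; trans; cong; cong₂; subst; subst₂; module ≡-Reasoning)

-- Power series

private variable
  a p q : Level
  A C : Set a

module PowerSeries (R : CommutativeRing a p) where
  open CommutativeRing R hiding (zero) renaming (refl to ≈-refl; sym to ≈-sym; trans to ≈-trans)
  open import Algebra.Properties.CommutativeSemigroup +-commutativeSemigroup using (interchange)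
  open import Algebra.Properties.Ring ring using (-0#≈0#)
  open import Relation.Binary.Reasoning.Setoid setoid

  tail : (ℕ → Carrier) → ℕ → Carrier
  tail f n = f (suc n)

  infixl 7 _⋆_
  -- The Cauchy product, by recursion on the degree instead of a finite sum, so that the ring laws
  -- follow by induction. The coefficient ring is arbitrary because the construction is iterated,
  -- once for each variable.
  _⋆_ : (ℕ → Carrier) → (ℕ → Carrier) → ℕ → Carrier
  (f ⋆ g) zero    = f 0 * g 0
  (f ⋆ g) (suc n) = f 0 * g (suc n) + (tail f ⋆ g) n

  const : Carrier → ℕ → Carrier
  const a zero    = a
  const a (suc _) = 0#

  ⋆-cong : ∀ {f f′ g g′} → (∀ n → f n ≈ f′ n) → (∀ n → g n ≈ g′ n) → ∀ n → (f ⋆ g) n ≈ (f′ ⋆ g′) n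
  ⋆-cong p q zero    = *-cong (p 0) (q 0)
  ⋆-cong p q (suc n) = +-cong (*-cong (p 0) (q (suc n))) (⋆-cong (λ k → p (suc k)) q n)

  ⋆-zeroˡ : ∀ f n → ((λ _ → 0#) ⋆ f) n ≈ 0#
  ⋆-zeroˡ f zero    = zeroˡ _
  ⋆-zeroˡ f (suc n) = ≈-trans (+-cong (zeroˡ _) (⋆-zeroˡ f n)) (+-identityˡ 0#)

  const-⋆ : ∀ a f n → (const a ⋆ f) n ≈ a * f n
  const-⋆ a f zero    = ≈-refl
  const-⋆ a f (suc n) = ≈-trans (+-congˡ (⋆-zeroˡ f n)) (+-identityʳ _)

  ⋆-distribʳ : ∀ h f g n → ((λ k → f k + g k) ⋆ h) n ≈ (f ⋆ h) n + (g ⋆ h) n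
  ⋆-distribʳ h f g zero    = distribʳ _ _ _
  ⋆-distribʳ h f g (suc n) =
    ≈-trans (+-cong (distribʳ _ _ _) (⋆-distribʳ h (tail f) (tail g) n)) (interchange _ _ _ _)

  *-⋆-assoc : ∀ a f g n → ((λ k → a * f k) ⋆ g) n ≈ a * (f ⋆ g) n
  *-⋆-assoc a f g zero    = *-assoc _ _ _
  *-⋆-assoc a f g (suc n) =
    ≈-trans (+-cong (*-assoc _ _ _) (*-⋆-assoc a (tail f) g n)) (≈-sym (distribˡ _ _ _))

  ⋆-assoc : ∀ f g h n → ((f ⋆ g) ⋆ h) n ≈ (f ⋆ (g ⋆ h)) n
  ⋆-assoc f g h zero    = *-assoc _ _ _
  ⋆-assoc f g h (suc n) = begin
    f 0 * g 0 * h (suc n) + ((λ k → f 0 * tail g k + (tail f ⋆ g) k) ⋆ h) n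
      ≈⟨ +-cong (*-assoc _ _ _) (⋆-distribʳ h (λ k → f 0 * tail g k) (tail f ⋆ g) n) ⟩
    f 0 * (g 0 * h (suc n)) + (((λ k → f 0 * tail g k) ⋆ h) n + ((tail f ⋆ g) ⋆ h) n)
      ≈⟨ +-congˡ (+-cong (*-⋆-assoc (f 0) (tail g) h n) (⋆-assoc (tail f) g h n)) ⟩
    f 0 * (g 0 * h (suc n)) + (f 0 * (tail g ⋆ h) n + (tail f ⋆ (g ⋆ h)) n)
      ≈⟨ +-assoc _ _ _ ⟨
    f 0 * (g 0 * h (suc n)) + f 0 * (tail g ⋆ h) n + (tail f ⋆ (g ⋆ h)) n
      ≈⟨ +-congʳ (distribˡ _ _ _) ⟨
    (f ⋆ (g ⋆ h)) (suc n) ∎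

  -- The defining recursion splits off `f 0`; commutativity also needs the mirror image, which
  -- splits off `g 0`.
  ⋆-suc : ∀ f g n → (f ⋆ g) (suc n) ≈ (f ⋆ tail g) n + f (suc n) * g 0
  ⋆-suc f g zero    = ≈-refl
  ⋆-suc f g (suc n) = ≈-trans (+-congˡ (⋆-suc (tail f) g n)) (≈-sym (+-assoc _ _ _))

  ⋆-comm : ∀ f g n → (f ⋆ g) n ≈ (g ⋆ f) n
  ⋆-comm f g zero    = *-comm _ _
  ⋆-comm f g (suc n) = begin
    f 0 * g (suc n) + (tail f ⋆ g) n ≈⟨ +-cong (*-comm _ _) (⋆-comm (tail f) g n) ⟩
    g (suc n) * f 0 + (g ⋆ tail f) n ≈⟨ +-comm _ _ ⟩
    (g ⋆ tail f) n + g (suc n) * f 0 ≈⟨ ⋆-suc g f n ⟨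
    (g ⋆ f) (suc n)                  ∎

  ⋆-identityˡ : ∀ f n → (const 1# ⋆ f) n ≈ f n
  ⋆-identityˡ f n = ≈-trans (const-⋆ 1# f n) (*-identityˡ _)

  powerSeries : CommutativeRing a p
  powerSeries = record
    { Carrier = ℕ → Carrier
    ; _≈_ = λ f g → ∀ n → f n ≈ g n
    ; _+_ = λ f g n → f n + g n
    ; _*_ = _⋆_
    ; -_  = λ f n → - f n
    ; 0#  = λ _ → 0#
    ; 1#  = const 1#
    ; isCommutativeRing = record
      { isRing = record
        { +-isAbelianGroup = record
          { isGroup = record
            { isMonoid = record
              { isSemigroup = record
                { isMagma = record
                  { isEquivalence = record
                    { refl = λ _ → ≈-refl ; sym = λ p n → ≈-sym (p n) ; trans = λ p q n → ≈-trans (p n) (q n) }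
                  ; ∙-cong = λ p q n → +-cong (p n) (q n) }
                ; assoc = λ f g h n → +-assoc _ _ _ }
              ; identity = (λ f n → +-identityˡ _) , (λ f n → +-identityʳ _) }
            ; inverse = (λ f n → -‿inverseˡ _) , (λ f n → -‿inverseʳ _)
            ; ⁻¹-cong = λ p n → -‿cong (p n) }
          ; comm = λ f g n → +-comm _ _ }
        ; *-cong = λ p q → ⋆-cong p q
        ; *-assoc = ⋆-assoc
        ; *-identity = ⋆-identityˡ , (λ f n → ≈-trans (⋆-comm f (const 1#) n) (⋆-identityˡ f n))
        ; distrib = (λ h f g n → ≈-trans (⋆-comm h _ n)
                       (≈-trans (⋆-distribʳ h f g n) (+-cong (⋆-comm f h n) (⋆-comm g h n))))
                  , ⋆-distribʳ }
      ; *-comm = ⋆-comm } }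

  const-+ : ∀ a b n → const (a + b) n ≈ const a n + const b n
  const-+ a b zero    = ≈-refl
  const-+ a b (suc n) = ≈-sym (+-identityˡ 0#)

  const-* : ∀ a b n → const (a * b) n ≈ (const a ⋆ const b) n
  const-* a b zero    = ≈-refl
  const-* a b (suc n) = ≈-sym (≈-trans (const-⋆ a (const b) (suc n)) (zeroʳ a))

  const-neg : ∀ a n → const (- a) n ≈ - const a n
  const-neg a zero    = ≈-refl
  const-neg a (suc n) = ≈-sym -0#≈0#

  const-0 : ∀ n → const 0# n ≈ 0#
  const-0 zero    = ≈-refl
  const-0 (suc _) = ≈-refl

  const-cong : ∀ {a b} → a ≈ b → ∀ n → const a n ≈ const b n
  const-cong p zero    = p
  const-cong p (suc _) = ≈-refl

  -- Divisibility by the `k`-th power of the variable, read off the coefficients.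
  VanishesBelow : ℕ → (ℕ → Carrier) → Set _
  VanishesBelow k f = ∀ n → n < k → f n ≈ 0#

  ⋆-vanishesBelow : ∀ k l {f g} → VanishesBelow k f → VanishesBelow l g → VanishesBelow (k ℕ.+ l) (f ⋆ g)
  ⋆-vanishesBelow zero    l p q zero    lt = ≈-trans (*-congˡ (q 0 lt)) (zeroʳ _)
  ⋆-vanishesBelow zero    l p q (suc n) lt =
    ≈-trans (+-cong (≈-trans (*-congˡ (q (suc n) lt)) (zeroʳ _))
                  (⋆-vanishesBelow zero l (λ _ ()) q n (<-trans (n<1+n n) lt)))
          (+-identityʳ 0#)
  ⋆-vanishesBelow (suc k) l p q zero    lt = ≈-trans (*-congʳ (p 0 z<s)) (zeroˡ _)
  ⋆-vanishesBelow (suc k) l p q (suc n) (s≤s lt) =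
    ≈-trans (+-cong (≈-trans (*-congʳ (p 0 z<s)) (zeroˡ _))
                  (⋆-vanishesBelow k l (λ i i<k → p (suc i) (s≤s i<k)) q n lt))
          (+-identityʳ 0#)

  -- A series `b` = 1 + `u` with `u` of positive order is a unit, but no inverse is constructed. By
  -- induction `f` has order at least `k`, so `u ⋆ f` has order at least `k` + 1, and up to degree
  -- `k` the coefficients of `f` and `b ⋆ f` agree.
  vanishesBelow-cancel : ∀ {b u} → (∀ n → b n ≈ const 1# n + u n) → u 0 ≈ 0# →
                         ∀ k f → VanishesBelow k (b ⋆ f) → VanishesBelow k f
  vanishesBelow-cancel _ _ zero    f bf n ()
  vanishesBelow-cancel {b} {u} b≈1+u u₀≈0 (suc k) f bf n n<1+k = begin
    f n                          ≈⟨ +-identityʳ _ ⟨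
    f n + 0#                     ≈⟨ +-cong (⋆-identityˡ f n) uf≈0 ⟨
    (const 1# ⋆ f) n + (u ⋆ f) n ≈⟨ ⋆-distribʳ f (const 1#) u n ⟨
    ((λ i → const 1# i + u i) ⋆ f) n ≈⟨ ⋆-cong b≈1+u (λ _ → ≈-refl) n ⟨
    (b ⋆ f) n                    ≈⟨ bf n n<1+k ⟩
    0#                           ∎
    where
    uf≈0 : (u ⋆ f) n ≈ 0#
    uf≈0 = ⋆-vanishesBelow 1 k (λ { zero _ → u₀≈0 ; (suc _) (s≤s ()) })
      (vanishesBelow-cancel b≈1+u u₀≈0 k f (λ i i<k → bf i (<-trans i<k (n<1+n k)))) n n<1+k

  var : ℕ → Carrier
  var 1 = 1#
  var _ = 0#

  tail-var : ∀ n → tail var n ≈ const 1# n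
  tail-var zero    = ≈-refl
  tail-var (suc _) = ≈-refl

  var-⋆-zero : ∀ f → (var ⋆ f) 0 ≈ 0#
  var-⋆-zero f = zeroˡ _

  var-⋆-suc : ∀ f n → (var ⋆ f) (suc n) ≈ f n
  var-⋆-suc f n = ≈-trans (+-cong (zeroˡ _) (≈-trans (⋆-cong tail-var (λ _ → ≈-refl) n) (⋆-identityˡ f n)))
                        (+-identityˡ _)

-- The kernel method

module Kernel (R : CommutativeRing a p)
  (ℤ⟶R : AlmostCommutativeRing.rawRing (fromCommutativeRing ℤ.+-*-commutativeRing)
           -Raw-AlmostCommutative⟶ fromCommutativeRing R) where
  open CommutativeRing R hiding (zero) renaming (refl to ≈-refl; sym to ≈-sym; trans to ≈-trans)
  open _-Raw-AlmostCommutative⟶_ ℤ⟶R using (⟦_⟧)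

  private
    image-≈ : ∀ {i j} → i ≡ j → ⟦ i ⟧ ≈ ⟦ j ⟧
    image-≈ refl = ≈-refl

    image-≈? : (i j : ℤ) → Maybe (⟦ i ⟧ ≈ ⟦ j ⟧)
    image-≈? i j = Maybe.map image-≈ (dec⇒maybe (i ℤ.≟ j))

  open Algebra.Solver.Ring _ _ ℤ⟶R image-≈? using (Polynomial; solve; _:+_; _:*_; _:-_; con; _:=_)
  open import Algebra.Properties.Ring ring using (-0#≈0#)
  open import Algebra.Properties.Semiring.Exp semiring using (_^_) public
  open import Relation.Binary.Reasoning.Setoid setoid

  -- The image of the integer 1 and not `1#`, so that it is literally what `con (+ 1)` denotes in
  -- the ring solver.
  one : Carrier
  one = ⟦ + 1 ⟧

  E : Carrier → Carrier → Carrier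
  E B x = x * (B * B) - (x - one) * (B - one)

  -- Unrolled, `S d` is the sum of `H i` over i ≤ d, and `W d` is the sum of `H i` over 1 ≤ i ≤ d +
  -- 1 plus the sum of (d - i) `H i` over i < d. The last sum grows by `S d` in each step.
  module Solution (B x y : Carrier) (H S W : ℕ → Carrier)
    (kernel : B ≈ one + x * (y * (B * B * E B x)))
    (S-zero : S 0 ≈ H 0)
    (S-suc  : ∀ d → S (suc d) ≈ S d + H (suc d))
    (W-zero : W 0 ≈ H 1)
    (W-suc  : ∀ d → W (suc d) ≈ W d + H (suc (suc d)) + S d)
    (H-zero : H 0 ≈ one + x * (y * (S 0 + x * W 0)))
    (H-suc  : ∀ d → H (suc d) ≈ H d + x * (y * (S (suc d) + x * W (suc d))))
    where

    -- The recurrences take (H d, H (d+1), S d, W d) linearly to its successor.  B / (B − 1) is an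
    -- eigenvalue of this map, and these are the coordinates of a left eigenvector.
    eigen : Carrier → Carrier → Carrier → Carrier → Carrier
    eigen h h′ s w =
      x * x * y * B * B * h′ - (B - one) * h
      - B * (B - one) * (x * y + x * x * y * B) * s - x * x * y * (B - one) * B * w

    -- At d = −1 the recurrences hold with H = 1 and S = W = 0.
    L : ℕ → Carrier
    L zero    = eigen one (H 0) 0# 0#
    L (suc d) = eigen (H d) (H (suc d)) (S d) (W d)

    B-1≈ : B - one ≈ x * (y * (B * B * E B x))
    B-1≈ = begin
      B - one                               ≈⟨ +-congʳ kernel ⟩
      one + x * (y * (B * B * E B x)) - one ≈⟨ solve 2 (λ a b → a :+ b :- a := b) ≈-refl one _ ⟩
      x * (y * (B * B * E B x))             ∎

    eigen-cong : ∀ {h₁ h₂ h₁′ h₂′ s₁ s₂ w₁ w₂} → h₁ ≈ h₂ → h₁′ ≈ h₂′ → s₁ ≈ s₂ → w₁ ≈ w₂ →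
                 eigen h₁ h₁′ s₁ w₁ ≈ eigen h₂ h₂′ s₂ w₂
    eigen-cong p q r t = +-cong (+-cong (+-cong (*-congˡ q) (-‿cong (*-congˡ p))) (-‿cong (*-congˡ r)))
                                (-‿cong (*-congˡ t))

    -- The recurrences for `H` and `W` eliminate `h₀` and `w₀`. In the remaining variables the two
    -- sides differ by `h₁` times the equation of `B`, which is a polynomial identity. The arguments
    -- are free so that the start d = -1 is covered too.
    eigen-step : ∀ {h₀ h₁ h₂ s₀ s₁ w₀ w₁} → s₁ ≈ s₀ + h₁ → w₁ ≈ w₀ + h₂ + s₀ →
                 h₁ ≈ h₀ + x * (y * (s₁ + x * w₁)) →
                 B * eigen h₀ h₁ s₀ w₀ ≈ (B - one) * eigen h₁ h₂ s₁ w₁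
    eigen-step {h₀} {h₁} {h₂} {s₀} {s₁} {w₀} {w₁} s-eq w-eq h-eq = begin
      B * eigen h₀ h₁ s₀ w₀
        ≈⟨ *-congˡ (eigen-cong h₀-eq ≈-refl ≈-refl w₀-eq) ⟩
      B * eigen (h₁ - x * (y * (s₀ + h₁ + x * w₁))) h₁ s₀ (w₁ - h₂ - s₀)
        ≈⟨ step-identity B x y h₁ h₂ s₀ w₁ ⟩
      (B - one) * eigen h₁ h₂ (s₀ + h₁) w₁ + h₁ * (x * (y * (B * B * E B x)) - (B - one))
        ≈⟨ +-congˡ (*-congˡ (≈-trans (+-congʳ (≈-sym B-1≈)) (-‿inverseʳ _))) ⟩
      (B - one) * eigen h₁ h₂ (s₀ + h₁) w₁ + h₁ * 0#
        ≈⟨ ≈-trans (+-congˡ (zeroʳ h₁)) (+-identityʳ _) ⟩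
      (B - one) * eigen h₁ h₂ (s₀ + h₁) w₁
        ≈⟨ *-congˡ (eigen-cong ≈-refl ≈-refl s-eq ≈-refl) ⟨
      (B - one) * eigen h₁ h₂ s₁ w₁ ∎
      where
      move : ∀ a b → a ≈ a + b - b
      move = solve 2 (λ a b → a := a :+ b :- b) ≈-refl
      h₀-eq : h₀ ≈ h₁ - x * (y * (s₀ + h₁ + x * w₁))
      h₀-eq = ≈-trans (move h₀ _) (+-cong (≈-sym h-eq) (-‿cong (*-congˡ (*-congˡ (+-congʳ s-eq)))))
      w₀-eq : w₀ ≈ w₁ - h₂ - s₀
      w₀-eq = ≈-trans (solve 3 (λ w h s → w := w :+ h :+ s :- h :- s) ≈-refl w₀ h₂ s₀)
                    (+-congʳ (+-congʳ (≈-sym w-eq)))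
      one′ : ∀ {n} → Polynomial n
      one′ = con (+ 1)
      E′ : ∀ {n} → Polynomial n → Polynomial n → Polynomial n
      E′ B x = x :* (B :* B) :- (x :- one′) :* (B :- one′)
      eigen′ : ∀ {n} (B x y h h′ s w : Polynomial n) → Polynomial n
      eigen′ B x y h h′ s w =
        x :* x :* y :* B :* B :* h′ :- (B :- one′) :* h
        :- B :* (B :- one′) :* (x :* y :+ x :* x :* y :* B) :* s :- x :* x :* y :* (B :- one′) :* B :* w
      step-identity : ∀ B x y h₁ h₂ s₀ w₁ → _
      step-identity = solve 7 (λ B x y h₁ h₂ s₀ w₁ →
        B :* eigen′ B x y (h₁ :- x :* (y :* (s₀ :+ h₁ :+ x :* w₁))) h₁ s₀ (w₁ :- h₂ :- s₀)
        := (B :- one′) :* eigen′ B x y h₁ h₂ (s₀ :+ h₁) w₁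
           :+ h₁ :* (x :* (y :* (B :* B :* E′ B x)) :- (B :- one′))) ≈-refl

    L-step : ∀ d → B * L d ≈ (B - one) * L (suc d)
    L-step zero    = eigen-step (≈-trans S-zero (≈-sym (+-identityˡ _)))
                                (≈-trans W-zero (≈-sym (≈-trans (+-identityʳ _) (+-identityˡ _)))) H-zero
    L-step (suc d) = eigen-step (S-suc d) (W-suc d) (H-suc d)

    -- Each application of the recurrences trades a factor `B` on the left for a factor `B - one` on
    -- the right. No division by `B` is needed.
    L-power : ∀ d → B ^ d * L 0 ≈ (B - one) ^ d * L d
    L-power zero    = ≈-refl
    L-power (suc d) = begin
      B * B ^ d * L 0
        ≈⟨ *-assoc _ _ _ ⟩
      B * (B ^ d * L 0)
        ≈⟨ *-congˡ (L-power d) ⟩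
      B * ((B - one) ^ d * L d)
        ≈⟨ solve 3 (λ a b c → a :* (b :* c) := b :* (a :* c)) ≈-refl B _ _ ⟩
      (B - one) ^ d * (B * L d)
        ≈⟨ *-congˡ (L-step d) ⟩
      (B - one) ^ d * ((B - one) * L (suc d))
        ≈⟨ solve 3 (λ a b c → b :* (a :* c) := a :* b :* c) ≈-refl (B - one) _ _ ⟩
      (B - one) * (B - one) ^ d * L (suc d) ∎

    -- At d = -1 the coordinates `s` and `w` are zero, so `L 0` is x²yB²H₀ - (B - 1), and the
    -- equation of `B` splits off xyB². The factors are nested so that they can be cancelled one at
    -- a time.
    L₀≈0⇒ : L 0 ≈ 0# → B * (B * (x * (y * (x * H 0 - E B x)))) ≈ 0#
    L₀≈0⇒ L₀≈0 = begin
      B * (B * (x * (y * (x * H 0 - E B x))))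
        ≈⟨ solve 5 (λ B x y h e →
             B :* (B :* (x :* (y :* (x :* h :- e))))
             := x :* x :* y :* B :* B :* h :- x :* (y :* (B :* B :* e))) ≈-refl B x y (H 0) (E B x) ⟩
      x * x * y * B * B * H 0 - x * (y * (B * B * E B x))
        ≈⟨ +-congˡ (-‿cong B-1≈) ⟨
      x * x * y * B * B * H 0 - (B - one)
        ≈⟨ +-congˡ (-‿cong (≈-trans (*-congˡ one≈1) (*-identityʳ _))) ⟨
      x * x * y * B * B * H 0 - (B - one) * one
        ≈⟨ ≈-trans (+-cong (+-congˡ (kill _)) (kill _)) (≈-trans (+-identityʳ _) (+-identityʳ _)) ⟨
      L 0
        ≈⟨ L₀≈0 ⟩
      0# ∎
      where
      one≈1 : one ≈ 1#
      one≈1 = _-Raw-AlmostCommutative⟶_.1-homo ℤ⟶R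
      kill : ∀ a → - (a * 0#) ≈ 0#
      kill a = ≈-trans (-‿cong (zeroʳ a)) -0#≈0#

-- Integer series in x and y, and the coefficients of H₀.

module GeneratingFunctions where
  open import Data.Integer using (_+_; _*_; _-_)

  ∑<-suc : ∀ n f → ∑< (suc n) f ≡ f 0 + ∑< n (f ∘ suc)
  ∑<-suc n f = cong (foldr _+_ 0ℤ) (map-upTo f (suc n)) ⟨ trans ⟩
               cong (λ l → f 0 + foldr _+_ 0ℤ l) (sym (map-upTo (f ∘ suc) n))

  -- The inner variable is y and the outer one is x, so the carrier of `X.powerSeries` is `Series`
  -- by computation and `X.VanishesBelow` measures the order in x.
  module Y = PowerSeries ℤ.+-*-commutativeRing
  module X = PowerSeries Y.powerSeries

  ⋆-∑ : ∀ f g n → (f Y.⋆ g) n ≡ ∑≤ n (λ i → f i * g (n ∸ i))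
  ⋆-∑ f g zero    = sym (trans (∑<-suc 0 (λ i → f i * g (0 ∸ i))) (ℤ.+-identityʳ (f 0 * g 0)))
  ⋆-∑ f g (suc n) = trans (cong (λ a → f 0 * g (suc n) + a) (⋆-∑ (f ∘ suc) g n))
                          (sym (∑<-suc (suc n) (λ i → f i * g (suc n ∸ i))))

  ⊗-⋆ : ∀ F G n m → (F ⊗ G) n m ≡ (F X.⋆ G) n m
  ⊗-⋆ F G zero    m = trans (∑<-suc 0 (λ i → ∑≤ m λ j → F i j * G (0 ∸ i) (m ∸ j)))
                            (trans (ℤ.+-identityʳ _) (sym (⋆-∑ (F 0) (G 0) m)))
  ⊗-⋆ F G (suc n) m = trans (∑<-suc (suc n) (λ i → ∑≤ m λ j → F i j * G (suc n ∸ i) (m ∸ j)))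
                            (cong₂ _+_ (sym (⋆-∑ (F 0) (G (suc n)) m)) (⊗-⋆ (F ∘ suc) G n m))

  𝟙-const : ∀ n m → 𝟙 n m ≡ X.const (Y.const 1ℤ) n m
  𝟙-const zero    zero    = refl
  𝟙-const zero    (suc m) = refl
  𝟙-const (suc n) m       = refl

  𝕩-var : ∀ n m → 𝕩 n m ≡ X.var n m
  𝕩-var zero          m       = refl
  𝕩-var (suc zero)    zero    = refl
  𝕩-var (suc zero)    (suc m) = refl
  𝕩-var (suc (suc n)) m       = refl

  𝕪-var : ∀ n m → 𝕪 n m ≡ X.const Y.var n m
  𝕪-var zero    zero          = refl
  𝕪-var zero    (suc zero)    = refl
  𝕪-var zero    (suc (suc m)) = refl
  𝕪-var (suc n) m             = refl

  ℤ⟶Series : AlmostCommutativeRing.rawRing (fromCommutativeRing ℤ.+-*-commutativeRing)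
               -Raw-AlmostCommutative⟶ fromCommutativeRing X.powerSeries
  ℤ⟶Series = record
    { ⟦_⟧    = λ a → X.const (Y.const a)
    ; +-homo = λ a b n m → trans (X.const-cong (Y.const-+ a b) n m) (X.const-+ _ _ n m)
    ; *-homo = λ a b n m → trans (X.const-cong (Y.const-* a b) n m) (X.const-* (Y.const a) (Y.const b) n m)
    ; -‿homo = λ a n m → trans (X.const-cong (Y.const-neg a) n m) (X.const-neg (Y.const a) n m)
    ; 0-homo = λ n m → trans (X.const-cong Y.const-0 n m) (X.const-0 n m)
    ; 1-homo = λ _ _ → refl
    }

  open CommutativeRing X.powerSeries public using ()
    renaming ( _≈_ to infix 4 _≋_; _+_ to infixl 6 _+ˢ_; _*_ to infixl 7 _*ˢ_; _-_ to infixl 6 _-ˢ_; 0# to 0ˢ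
             ; +-cong to +ˢ-cong; -‿cong to -ˢ-cong; refl to ≋-refl; trans to ≋-trans)
  open import Algebra.Properties.Ring (CommutativeRing.ring X.powerSeries) using (-1*x≈-x)
  open Kernel X.powerSeries ℤ⟶Series

  ⊗-* : ∀ {F F′ G G′} → F ≋ F′ → G ≋ G′ → F ⊗ G ≋ F′ *ˢ G′
  ⊗-* {F} {F′} {G} {G′} p q n m = trans (⊗-⋆ F G n m) (X.⋆-cong p q n m)

  xy : Series → Series
  xy F = X.var *ˢ (X.const Y.var *ˢ F)

  xy-zeroˡ : ∀ F m → xy F 0 m ≡ 0ℤ
  xy-zeroˡ F m = X.var-⋆-zero (X.const Y.var *ˢ F) m

  xy-zeroʳ : ∀ F n → xy F (suc n) 0 ≡ 0ℤ
  xy-zeroʳ F n = trans (X.var-⋆-suc (X.const Y.var *ˢ F) n 0)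
    (trans (X.const-⋆ Y.var F n 0) (Y.var-⋆-zero (F n)))

  xy-suc : ∀ F n m → xy F (suc n) (suc m) ≡ F n m
  xy-suc F n m = trans (X.var-⋆-suc (X.const Y.var *ˢ F) n (suc m))
    (trans (X.const-⋆ Y.var F n (suc m)) (Y.var-⋆-suc (F n) m))

  module _ (B : Series) (satB : SatisfiesB B) (H S W : ℕ → Series)
    (S-zero : S 0 ≋ H 0)
    (S-suc  : ∀ d → S (suc d) ≋ S d +ˢ H (suc d))
    (W-zero : W 0 ≋ H 1)
    (W-suc  : ∀ d → W (suc d) ≋ W d +ˢ H (suc (suc d)) +ˢ S d)
    (H-zero : H 0 ≋ one +ˢ xy (S 0 +ˢ X.var *ˢ W 0))
    (H-suc  : ∀ d → H (suc d) ≋ H d +ˢ xy (S (suc d) +ˢ X.var *ˢ W (suc d)))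
    where

    E′ : Series
    E′ = E B X.var

    u : Series
    u = xy (B *ˢ B *ˢ E′)

    B≋1+u : B ≋ one +ˢ u
    B≋1+u = ≋-trans satB (+ˢ-cong 𝟙-const (⊗-* 𝕩-var (⊗-* 𝕪-var (⊗-* (⊗-* ≋-refl ≋-refl)
      (+ˢ-cong (⊗-* 𝕩-var (⊗-* {B} {B} {B} {B} ≋-refl ≋-refl))
        (-ˢ-cong (⊗-* (+ˢ-cong 𝕩-var (-ˢ-cong 𝟙-const)) (+ˢ-cong (≋-refl {B}) (-ˢ-cong 𝟙-const)))))))))

    open Solution B X.var (X.const Y.var) H S W B≋1+u S-zero S-suc W-zero W-suc H-zero H-suc

    cancelB : ∀ k F → X.VanishesBelow k (B *ˢ F) → X.VanishesBelow k F
    cancelB = X.vanishesBelow-cancel B≋1+u (xy-zeroˡ (B *ˢ B *ˢ E′))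

    cancelB^ : ∀ d k F → X.VanishesBelow k (B ^ d *ˢ F) → X.VanishesBelow k F
    cancelB^ zero    k F p n n<k = λ m → trans (sym (X.⋆-identityˡ F n m)) (p n n<k m)
    cancelB^ (suc d) k F p = cancelB^ d k F (cancelB k (B ^ d *ˢ F)
      λ n n<k m → trans (sym (X.⋆-assoc B (B ^ d) F n m)) (p n n<k m))

    u-power : ∀ d → X.VanishesBelow d ((B -ˢ one) ^ d)
    u-power (suc d) = X.⋆-vanishesBelow 1 d
      (λ { zero _ m → trans (B-1≈ 0 m) (xy-zeroˡ (B *ˢ B *ˢ E′) m) ; (suc _) (s≤s ()) }) (u-power d)

    -- Since `B -ˢ one` is divisible by x, `L-power` makes `B ^ suc n *ˢ L 0` divisible by the power
    -- n + 1 of x. Cancelling the powers of `B` shows that the coefficient of degree n in `L 0` is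
    -- zero, for every n.
    L₀≋0 : L 0 ≋ 0ˢ
    L₀≋0 n = cancelB^ (suc n) (suc n) (L 0) vanishes n (n<1+n n)
      where
      vanishes : X.VanishesBelow (suc n) (B ^ suc n *ˢ L 0)
      vanishes i i≤n m = trans (L-power (suc n) i m)
        (X.⋆-vanishesBelow (suc n) 0 (u-power (suc n)) (λ _ ()) i
          (subst (i <_) (sym (ℕ.+-identityʳ (suc n))) i≤n) m)

    xH₀-E≋0 : X.var *ˢ H 0 -ˢ E′ ≋ 0ˢ
    -- The factor xy is cancelled by reading the coefficient one degree higher in both variables.
    -- Hence the two factors `B` are cancelled up to x-degree n + 1.
    xH₀-E≋0 n m = trans (sym (xy-suc (X.var *ˢ H 0 -ˢ E′) n m))
      (cancelB (suc (suc n)) (xy (X.var *ˢ H 0 -ˢ E′))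
        (cancelB (suc (suc n)) (B *ˢ xy (X.var *ˢ H 0 -ˢ E′)) (λ i _ → L₀≈0⇒ L₀≋0 i))
        (suc n) (n<1+n (suc n)) (suc m))

    B-zero : ∀ m → B 0 m ≡ Y.const 1ℤ m
    B-zero m = trans (B≋1+u 0 m)
      (trans (cong (λ a → Y.const 1ℤ m + a) (xy-zeroˡ (B *ˢ B *ˢ E′) m)) (ℤ.+-identityʳ _))

    -- This is the coefficient of degree n + 1 in x of the equation xH₀ = xB² - (x - 1)(B - 1).
    H₀-coefficient : ∀ n m → H 0 n m ≡ (B *ˢ B) n m - ((B -ˢ one) n m - (B -ˢ one) (suc n) m)
    H₀-coefficient n m = ℤ.i-j≡0⇒i≡j _ _ (trans
      (sym (cong₂ _-_ (X.var-⋆-suc (H 0) n m) (cong₂ _-_ (X.var-⋆-suc (B *ˢ B) n m) x-1)))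
      (xH₀-E≋0 (suc n) m))
      where
      x-1 : ((X.var -ˢ one) *ˢ (B -ˢ one)) (suc n) m ≡ (B -ˢ one) n m - (B -ˢ one) (suc n) m
      x-1 = trans (X.⋆-distribʳ (B -ˢ one) X.var (λ n m → ℤ.- one n m) (suc n) m)
        (cong₂ _+_ (X.var-⋆-suc (B -ˢ one) n m) (-1*x≈-x (B -ˢ one) (suc n) m))

    -- The x-constant coefficient of `B` is 1, so the first term of the square contributes
    -- `B (suc n) m`. It cancels the same term from (x - 1)(B - 1), which is why the sum starts at
    -- the index 1.
    H₀-formula : ∀ n m → H 0 (suc n) m ≡ B (suc (suc n)) m +
                   ∑< (suc n) (λ i → ∑≤ m (λ ℓ → B (suc i) ℓ * B (suc n ∸ suc i) (m ∸ ℓ)))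
    H₀-formula n m = begin
      H 0 (suc n) m
        ≡⟨ H₀-coefficient (suc n) m ⟩
      -- The x-degrees are positive here, so `one` contributes only the two `0ℤ`.
      (B 0 Y.⋆ B (suc n)) m + Σ - (B (suc n) m - 0ℤ - (B (suc (suc n)) m - 0ℤ))
        ≡⟨ cong₂ (λ a b → a + b - (B (suc n) m - 0ℤ - (B (suc (suc n)) m - 0ℤ)))
             (trans (Y.⋆-cong B-zero (λ _ → refl) m) (Y.⋆-identityˡ (B (suc n)) m))
             (sym (⊗-⋆ (B ∘ suc) B n m)) ⟩
      B (suc n) m + ((B ∘ suc) ⊗ B) n m - (B (suc n) m - 0ℤ - (B (suc (suc n)) m - 0ℤ))
        ≡⟨ rearrange (B (suc n) m) (B (suc (suc n)) m) (((B ∘ suc) ⊗ B) n m) ⟩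
      B (suc (suc n)) m + ((B ∘ suc) ⊗ B) n m ∎
      where
      open ≡-Reasoning
      Σ : ℤ
      Σ = ((B ∘ suc) X.⋆ B) n m
      rearrange : ∀ a b c → a + c - (a - 0ℤ - (b - 0ℤ)) ≡ b + c
      rearrange = solve-∀

-- Counting by insertion of the values in increasing order

module InversionSequences where
  open import Data.Nat using (_+_)
  open import Data.Nat.Properties using (+-comm; +-assoc; +-identityʳ; +-suc; +-cancelˡ-≡; +-cancelʳ-≡)

  -- Cardinality as a property of a predicate: recurrences can be proved by rewriting predicates,
  -- regardless of the order in which the listing enumerates.
  record Counted {A : Set a} (P : A → Set p) (k : ℕ) : Set (a ⊔ p) where
    constructor counted
    field
      elements : List A
      unique   : Unique elements
      sound    : ∀ {x} → x ∈ elements → P x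
      complete : ∀ {x} → P x → x ∈ elements
      size     : length elements ≡ k

  -- Duplicate-free lists with the same members are equal as bags, hence permutations of each other.
  counted-det : ∀ {P : A → Set p} {k l} → Counted P k → Counted P l → k ≡ l
  counted-det (counted xs u s c refl) (counted ys u′ s′ c′ refl) =
    ↭-length (∼bag⇒↭ (unique∧set⇒bag u u′ (mk⇔ (λ i → c′ (s i)) (λ i → c (s′ i)))))

  counted-⇔ : ∀ {P : A → Set p} {Q : A → Set q} {k} →
              (∀ {x} → P x → Q x) → (∀ {x} → Q x → P x) → Counted P k → Counted Q k
  counted-⇔ f g (counted xs u s c e) = counted xs u (λ i → f (s i)) (λ r → c (g r)) e

  counted-⊎ : ∀ {P : A → Set p} {Q : A → Set q} {k l} → (∀ {x} → P x → ¬ Q x) →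
              Counted P k → Counted Q l → Counted (λ x → P x ⊎ Q x) (k + l)
  counted-⊎ disjoint (counted xs u s c refl) (counted ys u′ s′ c′ refl) = counted (xs ++ ys)
    (Unique.++⁺ u u′ λ (i , j) → disjoint (s i) (s′ j))
    (λ i → [ (λ j → inj₁ (s j)) , (λ j → inj₂ (s′ j)) ]′ (∈-++⁻ xs i))
    [ (λ r → ∈-++⁺ˡ (c r)) , (λ r → ∈-++⁺ʳ xs (c′ r)) ]′
    (length-++ xs)

  counted-map : ∀ {P : A → Set p} {k} (f : A → C) → (∀ {x y} → f x ≡ f y → x ≡ y) →
                Counted P k → Counted (λ y → ∃ λ x → y ≡ f x × P x) k
  counted-map f inj (counted xs u s c refl) = counted (map f xs) (Unique.map⁺ inj u)
    (λ i → let (x , j , e) = ∈-map⁻ f i in x , e , s j)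
    (λ { (x , refl , r) → ∈-map⁺ f (c r) })
    (length-map f xs)

  counted-∅ : ∀ {P : A → Set p} → (∀ {x} → ¬ P x) → Counted P 0
  counted-∅ none = counted [] [] (λ ()) (λ r → contradiction r none) refl

  counted-[_] : (x : A) → Counted (_≡ x) 1
  counted-[ x ] = counted (x ∷ []) ([] ∷ []) (λ { (here e) → e }) here refl

  -- Distinct values above a threshold and letters below it.

  newDist : ℕ → List ℕ → ℕ
  newDist v s = length (filter (v ≤?_) (deduplicate _≟_ s))

  counted-newDist : ∀ v s → Counted (λ u → u ∈ s × v ≤ u) (newDist v s)
  counted-newDist v s = counted _ (Unique.filter⁺ (v ≤?_) (deduplicate-! _≟_ s))
    (λ i → let (j , v≤u) = ∈-filter⁻ (v ≤?_) i in ∈-deduplicate⁻ _≟_ s j , v≤u)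
    (λ (j , v≤u) → ∈-filter⁺ (v ≤?_) (∈-deduplicate⁺ _≟_ j) v≤u)
    refl

  newDist-cong : ∀ v w s t → (∀ {u} → u ∈ s × v ≤ u → u ∈ t × w ≤ u) →
                 (∀ {u} → u ∈ t × w ≤ u → u ∈ s × v ≤ u) → newDist v s ≡ newDist w t
  newDist-cong v w s t f g = counted-det (counted-⇔ f g (counted-newDist v s)) (counted-newDist w t)

  newDist-∉ : ∀ {v s} → v ∉ s → newDist v s ≡ newDist (suc v) s
  newDist-∉ {v} {s} v∉s = newDist-cong v (suc v) s s
    (λ (i , v≤u) → i , ≤∧≢⇒< v≤u λ { refl → v∉s i })
    (λ (i , v<u) → i , <⇒≤ v<u)

  newDist-∈ : ∀ {v s} → v ∈ s → newDist v s ≡ suc (newDist (suc v) s)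
  newDist-∈ {v} {s} v∈s = counted-det (counted-newDist v s)
    (counted-⇔ [ (λ { refl → v∈s , ≤-refl }) , (λ (i , v<u) → i , <⇒≤ v<u) ]′ split
      (counted-⊎ (λ { refl (_ , v<v) → <-irrefl refl v<v }) counted-[ v ] (counted-newDist (suc v) s)))
    where
    split : ∀ {u} → u ∈ s × v ≤ u → u ≡ v ⊎ u ∈ s × v < u
    split {u} (i , v≤u) with u ≟ v
    ... | yes u≡v = inj₁ u≡v
    ... | no  u≢v = inj₂ (i , ≤∧≢⇒< v≤u λ e → u≢v (sym e))

  newDist-∷ : ∀ {v f} → f < v → ∀ s → newDist v (f ∷ s) ≡ newDist v s
  newDist-∷ {v} {f} f<v s = newDist-cong v v (f ∷ s) s
    (λ { (here refl , v≤f) → contradiction v≤f (<⇒≱ f<v) ; (there i , v≤u) → i , v≤u })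
    (λ (i , v≤u) → there i , v≤u)

  newDist-∷ʳ : ∀ {v f} → f < v → ∀ s → newDist v (s ∷ʳ f) ≡ newDist v s
  newDist-∷ʳ {v} {f} f<v s = newDist-cong v v (s ∷ʳ f) s
    (λ (i , v≤u) → [ (λ j → j , v≤u) , (λ { (here refl) → contradiction v≤u (<⇒≱ f<v) }) ]′ (∈-++⁻ s i))
    (λ (i , v≤u) → ∈-++⁺ˡ i , v≤u)

  below : ℕ → List ℕ → List ℕ
  below v = filter (_<? v)

  ⊆-∷ʳ⁻ : ∀ {as : List A} s {f} → as ⊆ s ∷ʳ f → as ⊆ s ⊎ ∃ λ bs → as ≡ bs ∷ʳ f × bs ⊆ s
  ⊆-∷ʳ⁻ []      (f skip τ)   = inj₁ τ
  ⊆-∷ʳ⁻ []      (refl ∷ []) = inj₂ ([] , refl , [])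
  ⊆-∷ʳ⁻ (x ∷ s) (.x skip τ) with ⊆-∷ʳ⁻ s τ
  ... | inj₁ σ            = inj₁ (x skip σ)
  ... | inj₂ (bs , e , σ) = inj₂ (bs , e , x skip σ)
  ⊆-∷ʳ⁻ (x ∷ s) (refl ∷ τ) with ⊆-∷ʳ⁻ s τ
  ... | inj₁ σ            = inj₁ (refl ∷ σ)
  ... | inj₂ (bs , e , σ) = inj₂ (x ∷ bs , cong (x ∷_) e , refl ∷ σ)

  ⊆-∷ʳ : ∀ {as s : List A} f → as ⊆ s → as ⊆ s ∷ʳ f
  ⊆-∷ʳ f τ = subst (_⊆ _) (++-identityʳ _) (++⁺ τ (minimum [ f ]))

  below-∷ʳ-< : ∀ {v f} s → f < v → below v (s ∷ʳ f) ≡ below v s ∷ʳ f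
  below-∷ʳ-< {v} s f<v = trans (filter-++ (_<? v) s _) (cong (below v s ++_) (filter-accept (_<? v) f<v))

  below-∷ʳ-≥ : ∀ {v f} s → ¬ f < v → below v (s ∷ʳ f) ≡ below v s
  below-∷ʳ-≥ {v} s f≮v = trans (filter-++ (_<? v) s _)
    (trans (cong (below v s ++_) (filter-reject (_<? v) f≮v)) (++-identityʳ _))

  below-< : ∀ v s → All (_< v) (below v s)
  below-< v s = Allₚ.all-filter (_<? v) s

  ⊆-below : ∀ {v as s} → All (_< v) as → as ⊆ s → as ⊆ below v s
  ⊆-below {v} as<v τ = subst (_⊆ _) (filter-all (_<? v) as<v) (filter⁺ (_<? v) (_<? v) (λ { refl x<v → x<v }) τ)

  below-∷-< : ∀ {v x s} → x < v → below v (x ∷ s) ≡ x ∷ below v s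
  below-∷-< {v} = filter-accept (_<? v)

  below-∷-≥ : ∀ {v x s} → ¬ x < v → below v (x ∷ s) ≡ below v s
  below-∷-≥ {v} = filter-reject (_<? v)

  below-below : ∀ v s → below v (below (suc v) s) ≡ below v s
  below-below v [] = refl
  below-below v (x ∷ s) with x <? v
  ... | yes x<v = trans (cong (below v) (below-∷-< (m<n⇒m<1+n x<v)))
    (trans (below-∷-< x<v) (trans (cong (x ∷_) (below-below v s)) (sym (below-∷-< x<v))))
  ... | no x≮v with x <? suc v
  ...   | yes x<1+v = trans (cong (below v) (below-∷-< x<1+v))
    (trans (below-∷-≥ x≮v) (trans (below-below v s) (sym (below-∷-≥ x≮v))))
  ...   | no x≮1+v = trans (cong (below v) (below-∷-≥ x≮1+v))
    (trans (below-below v s) (sym (below-∷-≥ x≮v)))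

  Sorted : List ℕ → Set
  Sorted s = ∀ {x y} → x ∷ y ∷ [] ⊆ s → x ≤ y

  -- An occurrence is a sublist and not a triple of indices, so it passes to and from `below` and
  -- shorter words by transitivity.
  Avoids102 : List ℕ → Set
  Avoids102 s = ∀ {x y z} → x ∷ y ∷ z ∷ [] ⊆ s → y < x → ¬ x < z

  Avoids000From : ℕ → List ℕ → Set
  Avoids000From v s = ∀ {u} → v ≤ u → ¬ u ∷ u ∷ u ∷ [] ⊆ s

  Bounded : ℕ → List ℕ → Set
  Bounded b []      = ⊤
  Bounded b (x ∷ s) = x ≤ b × Bounded (suc b) s

  Bounded-∷ʳ⁺ : ∀ {b x} s → Bounded b s → x ≤ b + length s → Bounded b (s ∷ʳ x)
  Bounded-∷ʳ⁺ {b} [] _ x≤ = subst (_ ≤_) (+-identityʳ b) x≤ , tt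
  Bounded-∷ʳ⁺ {b} {x} (y ∷ s) (y≤ , bs) x≤ = y≤ , Bounded-∷ʳ⁺ s bs (subst (x ≤_) (+-suc b (length s)) x≤)

  Bounded-∷ʳ⁻ : ∀ {b x} s → Bounded b (s ∷ʳ x) → Bounded b s × x ≤ b + length s
  Bounded-∷ʳ⁻ {b} [] (x≤ , _) = tt , subst (_ ≤_) (sym (+-identityʳ b)) x≤
  Bounded-∷ʳ⁻ {b} {x} (y ∷ s) (y≤ , bs) with Bounded-∷ʳ⁻ s bs
  ... | bs′ , x≤ = (y≤ , bs′) , subst (x ≤_) (sym (+-suc b (length s))) x≤

  -- s is a finished word whose letters below v form the word w.  It has n letters ≥ v, with m distinct
  -- values.  The shifted bound b allows s to be a suffix of an inversion sequence, and 000 concerns only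
  -- letters ≥ v, since smaller letters may also occur to the left of that suffix.
  record Extends (b v : ℕ) (w : List ℕ) (n m : ℕ) (s : List ℕ) : Set where
    constructor extends
    field
      below≡      : below v s ≡ w
      avoids102   : Avoids102 s
      avoids000   : Avoids000From v s
      bounded     : Bounded b s
      length≡     : length s ≡ length w + n
      newDist≡    : newDist v s ≡ m

  -- Removing the first or the last letter of a finished word.

  length-∷ʳ : ∀ (s : List A) x → length (s ∷ʳ x) ≡ suc (length s)
  length-∷ʳ s x = trans (length-++ s) (+-comm (length s) 1)

  -- The bound forces the first letter of `s` to be at most `v`, so it survives in `below (suc v) s`
  -- and must be `f`. No later value can be placed before it, and the rest of the word starts with
  -- the bound `suc v`.
  freeze⁻ : ∀ {v f w n m s} → f < suc v → Extends v (suc v) (f ∷ w) n m s →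
            ∃ λ t → s ≡ f ∷ t × Extends (suc v) (suc v) w n m t
  freeze⁻ {s = []} f<1+v (extends () _ _ _ _ _)
  freeze⁻ {v} {s = x ∷ t} f<1+v (extends e a z (x≤v , bd) l d)
    with refl , e′ ← ∷-injective (trans (sym (below-∷-< (s≤s x≤v))) e) =
    t , refl , extends e′ (λ τ → a (_ skip τ)) (λ v≤u τ → z v≤u (_ skip τ)) bd (suc-injective l)
      (trans (sym (newDist-∷ f<1+v t)) d)

  -- In a new 102 the letter `f` would come first and be followed by a smaller letter; that letter
  -- lies in `w`, against sortedness. A new 000 would consist of copies of `f`, which is below the
  -- threshold.
  freeze⁺ : ∀ {v f w n m t} → f < suc v → Sorted (f ∷ w) → Extends (suc v) (suc v) w n m t →
            Extends v (suc v) (f ∷ w) n m (f ∷ t)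
  freeze⁺ {v} {f} {w} {t = t} f<1+v sorted (extends refl a z bd l d) = extends
    (below-∷-< f<1+v) a′ z′ (≤-pred f<1+v , bd) (cong suc l) (trans (newDist-∷ f<1+v t) d)
    where
    a′ : Avoids102 (f ∷ t)
    a′ (_ skip τ) = a τ
    a′ (refl ∷ τ) y<f f<z = contradiction y<f (≤⇒≯ (sorted (refl ∷
      ⊆-below (<-trans y<f f<1+v ∷ []) (⊆-trans (refl ∷ minimum _) τ))))
    z′ : Avoids000From (suc v) (f ∷ t)
    z′ v<u (_ skip τ) = z v<u τ
    z′ v<u (refl ∷ τ) = contradiction v<u (<⇒≱ f<1+v)

  -- A first letter would be at most `v` by the bound, but no such letter is present. This is where
  -- the construction stops.
  freeze-[]⁻ : ∀ {v n m s} → Extends v (suc v) [] n m s → s ≡ [] × n ≡ 0 × m ≡ 0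
  freeze-[]⁻ {s = []} (extends _ _ _ _ l d) = refl , sym l , sym d
  freeze-[]⁻ {s = x ∷ s} (extends e _ _ (x≤v , _) _ _) with () ← trans (sym (below-∷-< (s≤s x≤v))) e

  freeze-[]⁺ : ∀ {v} → Extends v (suc v) [] 0 0 []
  freeze-[]⁺ = extends refl (λ ()) (λ { _ () }) tt refl refl

  -- A letter ≥ v cannot follow a descent of letters below v, so the last letter of s is below v.
  tail⁻ : ∀ {b v w f x y n m s} → All (_< v) (w ∷ʳ f) → x ∷ y ∷ [] ⊆ w ∷ʳ f → y < x →
          Extends b v (w ∷ʳ f) n m s → ∃ λ t → s ≡ t ∷ʳ f × Extends b v w n m t
  tail⁻ {v = v} {w} {f} {x} {y} {n} {s = s} w<v τ y<x (extends e a z bd l d) with initLast s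
  ... | [] with () ← subst (_ ⊆_) (sym e) τ
  ... | t ∷ʳ′ g with g <? v
  ...   | yes g<v with e′ , refl ← ∷ʳ-injective (below v t) w (trans (sym (below-∷ʳ-< t g<v)) e) =
    t , refl , extends e′ (λ σ → a (⊆-∷ʳ g σ)) (λ v≤u σ → z v≤u (⊆-∷ʳ g σ)) (proj₁ (Bounded-∷ʳ⁻ t bd))
      (suc-injective (trans (sym (length-∷ʳ t g)) (trans l (cong (_+ n) (length-∷ʳ w f)))))
      (trans (sym (newDist-∷ʳ g<v t)) d)
  ...   | no g≮v = contradiction (<-≤-trans x<v (≮⇒≥ g≮v)) (a (descent (⊆-∷ʳ⁻ t xy⊆s)) y<x)
    where
    x<v : x < v
    x<v = All.head (All-resp-⊆ τ w<v)
    y<v : y < v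
    y<v = All.head (All.tail (All-resp-⊆ τ w<v))
    xy⊆s : x ∷ y ∷ [] ⊆ t ∷ʳ g
    xy⊆s = ⊆-trans (subst (_ ⊆_) (sym e) τ) (filter-⊆ (_<? v) (t ∷ʳ g))
    descent : x ∷ y ∷ [] ⊆ t ⊎ (∃ λ bs → x ∷ y ∷ [] ≡ bs ∷ʳ g × bs ⊆ t) → x ∷ y ∷ g ∷ [] ⊆ t ∷ʳ g
    descent (inj₁ σ) = ++⁺ σ ⊆-refl
    descent (inj₂ (bs , eq , _)) with _ , refl ← ∷ʳ-injective [ x ] bs eq = contradiction y<v g≮v

  -- From `f` < `v` ≤ `b` + 1 follows `f` ≤ `b`, so the bound holds at any position. A 102 whose
  -- largest letter is below `v` lies entirely in `w ∷ʳ f`; any other one cannot end in `f` and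
  -- already occurs in `t`.
  tail⁺ : ∀ {b v w f n m t} → v ≤ suc b → All (_< v) (w ∷ʳ f) → Avoids102 (w ∷ʳ f) →
          Extends b v w n m t → Extends b v (w ∷ʳ f) n m (t ∷ʳ f)
  tail⁺ {b} {v} {w} {f} {n} {t = t} v≤1+b w<v av (extends refl a z bd l d) = extends
    (below-∷ʳ-< t f<v) a′ z′ (Bounded-∷ʳ⁺ t bd (≤-trans (≤-pred (<-≤-trans f<v v≤1+b)) (m≤m+n b _)))
    (trans (length-∷ʳ t f) (trans (cong suc l) (cong (_+ n) (sym (length-∷ʳ w f)))))
    (trans (newDist-∷ʳ f<v t) d)
    where
    f<v : f < v
    f<v = All.head (Allₚ.++⁻ʳ w w<v)
    a′ : Avoids102 (t ∷ʳ f)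
    a′ {x} {y} {z} τ y<x x<z with z <? v
    ... | yes z<v = av (subst (_ ⊆_) (below-∷ʳ-< t f<v)
                     (⊆-below (<-trans x<z z<v ∷ <-trans (<-trans y<x x<z) z<v ∷ z<v ∷ []) τ)) y<x x<z
    ... | no  z≮v with ⊆-∷ʳ⁻ t τ
    ...   | inj₁ σ = a σ y<x x<z
    ...   | inj₂ (bs , eq , _) with _ , refl ← ∷ʳ-injective (x ∷ [ y ]) bs eq = z≮v f<v
    z′ : Avoids000From v (t ∷ʳ f)
    z′ {u} v≤u τ with ⊆-∷ʳ⁻ t τ
    ... | inj₁ σ = z v≤u σ
    ... | inj₂ (bs , eq , _) with _ , refl ← ∷ʳ-injective (u ∷ [ u ]) bs eq = <⇒≱ f<v v≤u

  -- Inserting copies of one value.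

  rev : List ℕ → List ℕ
  rev []      = []
  rev (x ∷ r) = rev r ∷ʳ x

  -- The function `rev` unfolds to `∷ʳ` by computation, as the last-letter cases of `Insertion`
  -- require; this link to `reverse` supplies the involution.
  rev≡reverse : ∀ r → rev r ≡ reverse r
  rev≡reverse []      = refl
  rev≡reverse (x ∷ r) = trans (cong (_∷ʳ x) (rev≡reverse r)) (sym (unfold-reverse x r))

  rev-reverse : ∀ w → rev (reverse w) ≡ w
  rev-reverse w = trans (rev≡reverse (reverse w)) (reverse-involutive w)

  length-rev : ∀ r → length (rev r) ≡ length r
  length-rev []      = refl
  length-rev (x ∷ r) = trans (length-∷ʳ (rev r) x) (cong suc (length-rev r))

  rev-<⁺ : ∀ {v} r → All (_< v) r → All (_< v) (rev r)
  rev-<⁺ []      []          = []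
  rev-<⁺ (x ∷ r) (x<v ∷ r<v) = Allₚ.∷ʳ⁺ (rev-<⁺ r r<v) x<v

  rev-<⁻ : ∀ {v} r → All (_< v) (rev r) → All (_< v) r
  rev-<⁻ []      []    = []
  rev-<⁻ (x ∷ r) rx<v with Allₚ.∷ʳ⁻ rx<v
  ... | r<v , x<v = x<v ∷ rev-<⁻ r r<v

  -- w arises from rev r by inserting k copies of v.  The letters of r are reversed because the last letter
  -- of w decides the case.
  Insertion : ℕ → ℕ → List ℕ → List ℕ → Set
  Insertion v zero    r       w = w ≡ rev r
  Insertion v (suc k) []      w = ∃ λ w₀ → w ≡ w₀ ∷ʳ v × Insertion v k [] w₀
  Insertion v (suc k) (f ∷ r) w = (∃ λ w₀ → w ≡ w₀ ∷ʳ v × Insertion v k (f ∷ r) w₀)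
                                ⊎ (∃ λ w₀ → w ≡ w₀ ∷ʳ f × Insertion v (suc k) r w₀)

  insert-last : ∀ {v} k r {w} → Insertion v k r w → Insertion v (suc k) r (w ∷ʳ v)
  insert-last k []      i = _ , refl , i
  insert-last k (f ∷ r) i = inj₁ (_ , refl , i)

  module _ {v : ℕ} where
    insertion-≤ : ∀ k r {w} → All (_< v) r → Insertion v k r w → All (_< suc v) w
    insertion-≤ zero    r       r<v refl                 = All.map m<n⇒m<1+n (rev-<⁺ r r<v)
    insertion-≤ (suc k) []      r<v (_ , refl , i)       = Allₚ.∷ʳ⁺ (insertion-≤ k [] r<v i) ≤-refl
    insertion-≤ (suc k) (f ∷ r) r<v (inj₁ (_ , refl , i)) = Allₚ.∷ʳ⁺ (insertion-≤ k (f ∷ r) r<v i) ≤-refl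
    insertion-≤ (suc k) (f ∷ r) (f<v ∷ r<v) (inj₂ (_ , refl , i)) =
      Allₚ.∷ʳ⁺ (insertion-≤ (suc k) r r<v i) (m<n⇒m<1+n f<v)

    below-insertion : ∀ k r {w} → All (_< v) r → Insertion v k r w → below v w ≡ rev r
    below-insertion zero    r       r<v refl = filter-all (_<? v) (rev-<⁺ r r<v)
    below-insertion (suc k) []      r<v (w , refl , i) =
      trans (below-∷ʳ-≥ w (<-irrefl refl)) (below-insertion k [] r<v i)
    below-insertion (suc k) (f ∷ r) r<v (inj₁ (w , refl , i)) =
      trans (below-∷ʳ-≥ w (<-irrefl refl)) (below-insertion k (f ∷ r) r<v i)
    below-insertion (suc k) (f ∷ r) (f<v ∷ r<v) (inj₂ (w , refl , i)) =
      trans (below-∷ʳ-< w f<v) (cong (_∷ʳ f) (below-insertion (suc k) r r<v i))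

    length-insertion : ∀ k r {w} → Insertion v k r w → length w ≡ k + length r
    length-insertion zero    r       refl = length-rev r
    length-insertion (suc k) []      (w , refl , i) = trans (length-∷ʳ w v) (cong suc (length-insertion k [] i))
    length-insertion (suc k) (f ∷ r) (inj₁ (w , refl , i)) =
      trans (length-∷ʳ w v) (cong suc (length-insertion k (f ∷ r) i))
    length-insertion (suc k) (f ∷ r) (inj₂ (w , refl , i)) =
      trans (length-∷ʳ w f) (trans (cong suc (length-insertion (suc k) r i)) (sym (+-suc (suc k) (length r))))

    ∈-insertion : ∀ k r {w} → Insertion v (suc k) r w → v ∈ w
    ∈-insertion k []      (w , refl , i)        = ∈-++⁺ʳ w (here refl)
    ∈-insertion k (f ∷ r) (inj₁ (w , refl , i)) = ∈-++⁺ʳ w (here refl)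
    ∈-insertion k (f ∷ r) (inj₂ (w , refl , i)) = ∈-++⁺ˡ (∈-insertion k r i)

    occurrences : List ℕ → List ℕ
    occurrences = filter (_≟ v)

    occurrences-insertion : ∀ k r {w} → All (_< v) r → Insertion v k r w → length (occurrences w) ≡ k
    occurrences-insertion zero [] r<v refl = refl
    occurrences-insertion zero (f ∷ r) (f<v ∷ r<v) refl = trans
      (cong length (trans (filter-++ (_≟ v) (rev r) [ f ])
        (trans (cong (occurrences (rev r) ++_) (filter-reject (_≟ v) (<⇒≢ f<v))) (++-identityʳ _))))
      (occurrences-insertion zero r r<v refl)
    occurrences-insertion (suc k) [] r<v (w , refl , i) = trans
      (cong length (trans (filter-++ (_≟ v) w [ v ]) (cong (occurrences w ++_) (filter-accept (_≟ v) refl))))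
      (trans (length-∷ʳ (occurrences w) v) (cong suc (occurrences-insertion k [] r<v i)))
    occurrences-insertion (suc k) (f ∷ r) r<v (inj₁ (w , refl , i)) = trans
      (cong length (trans (filter-++ (_≟ v) w [ v ]) (cong (occurrences w ++_) (filter-accept (_≟ v) refl))))
      (trans (length-∷ʳ (occurrences w) v) (cong suc (occurrences-insertion k (f ∷ r) r<v i)))
    occurrences-insertion (suc k) (f ∷ r) (f<v ∷ r<v) (inj₂ (w , refl , i)) = trans
      (cong length (trans (filter-++ (_≟ v) w [ f ])
        (trans (cong (occurrences w ++_) (filter-reject (_≟ v) (<⇒≢ f<v))) (++-identityʳ _))))
      (occurrences-insertion (suc k) r r<v i)

    ∷-replicate : ∀ k → v ∷ replicate k v ≡ replicate k v ∷ʳ v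
    ∷-replicate zero    = refl
    ∷-replicate (suc k) = cong (v ∷_) (∷-replicate k)

    replicate-⊆-insertion : ∀ k r {w} → Insertion v k r w → replicate k v ⊆ w
    replicate-⊆-insertion zero    r       i = minimum _
    replicate-⊆-insertion (suc k) []      (w , refl , i) =
      subst (_⊆ _) (sym (∷-replicate k)) (++⁺ (replicate-⊆-insertion k [] i) ⊆-refl)
    replicate-⊆-insertion (suc k) (f ∷ r) (inj₁ (w , refl , i)) =
      subst (_⊆ _) (sym (∷-replicate k)) (++⁺ (replicate-⊆-insertion k (f ∷ r) i) ⊆-refl)
    replicate-⊆-insertion (suc k) (f ∷ r) (inj₂ (w , refl , i)) = ⊆-∷ʳ f (replicate-⊆-insertion (suc k) r i)

    -- Reading `rev u` from its end, a letter not below `v` equals `v` and is an inserted copy,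
    -- while a letter below `v` must be the last letter of `rev r`.
    insertion-exists : ∀ u r → All (_< suc v) u → below v (rev u) ≡ rev r → ∃ λ k → Insertion v k r (rev u)
    insertion-exists [] []      _ e = 0 , refl
    insertion-exists [] (f ∷ r) _ e with rev r
    ... | []    with () ← e
    ... | _ ∷ _ with () ← e
    insertion-exists (x ∷ u) r (x<1+v ∷ u<1+v) e with x <? v
    ... | no  x≮v with refl ← ≤-antisym (≤-pred x<1+v) (≮⇒≥ x≮v)
                  with k , i ← insertion-exists u r u<1+v (trans (sym (below-∷ʳ-≥ (rev u) x≮v)) e) =
      suc k , insert-last k r i
    insertion-exists (x ∷ u) [] (x<1+v ∷ u<1+v) e | yes x<v
      with below v (rev u) | trans (sym (below-∷ʳ-< (rev u) x<v)) e
    ... | []    | ()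
    ... | _ ∷ _ | ()
    insertion-exists (x ∷ u) (f ∷ r) (x<1+v ∷ u<1+v) e | yes x<v
      with e′ , refl ← ∷ʳ-injective (below v (rev u)) (rev r) (trans (sym (below-∷ʳ-< (rev u) x<v)) e)
      with insertion-exists u r u<1+v e′
    ... | zero  , i = zero , cong (_∷ʳ x) i
    ... | suc k , i = suc k , inj₂ (_ , refl , i)

  -- The largest letter of a 102 is at most `v`, so the other two are below `v` and form a descent
  -- in `below v w`.
  avoids102 : ∀ {v w} → Sorted (below v w) → All (_< suc v) w → Avoids102 w
  avoids102 sorted w<1+v τ y<x x<z with All-resp-⊆ τ w<1+v
  ... | _ ∷ _ ∷ z<1+v ∷ [] = <⇒≱ y<x (sorted
    (⊆-below (<-≤-trans x<z (≤-pred z<1+v) ∷ <-trans y<x (<-≤-trans x<z (≤-pred z<1+v)) ∷ [])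
      (⊆-trans (refl ∷ refl ∷ minimum _) τ)))

  -- The intermediate stage: the threshold has moved to `suc v`, but the bound is still `v` because
  -- no letter has been frozen for this value.
  Placed : ℕ → List ℕ → ℕ → ℕ → ℕ → List ℕ → Set
  Placed v r k n m s = ∃ λ w → Insertion v k r w × Extends v (suc v) w n m s

  isSuc : ℕ → ℕ
  isSuc zero    = 0
  isSuc (suc _) = 1

  module _ {v : ℕ} {r : List ℕ} (r<v : All (_< v) r) where
    placed-newDist : ∀ {k n m s} → Placed v r k n m s → newDist v s ≡ isSuc k + m
    placed-newDist {zero} {s = s} (w , refl , extends e a z bd l d) = trans (newDist-∉ v∉s) d
      where
      v∉s : v ∉ s
      v∉s i = <-irrefl refl (All.lookup (rev-<⁺ r r<v) (subst (v ∈_) e (∈-filter⁺ (_<? suc v) i ≤-refl)))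
    placed-newDist {suc k} {s = s} (w , i , extends e a z bd l d) = trans
      (newDist-∈ (proj₁ (∈-filter⁻ (_<? suc v) {xs = s} (subst (v ∈_) (sym e) (∈-insertion k r i)))))
      (cong suc d)

    extend-insertion : ∀ {k n m s} → k ≤ 2 → Placed v r k n m s → Extends v v (rev r) (k + n) (isSuc k + m) s
    extend-insertion {k} {n} {m} {s} k≤2 P@(w , i , extends e a z bd l d) = extends
      (trans (sym (below-below v s)) (trans (cong (below v) e) (below-insertion k r r<v i)))
      a z′ bd
      (trans l (trans (cong (_+ n) lw) (+-assoc (length (rev r)) k n)))
      (placed-newDist P)
      where
      lw : length w ≡ length (rev r) + k
      lw = trans (length-insertion k r i) (trans (+-comm k _) (cong (_+ k) (sym (length-rev r))))
      z′ : Avoids000From v s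
      z′ {u} v≤u τ with u ≟ v
      ... | no u≢v = z (≤∧≢⇒< v≤u (λ p → u≢v (sym p))) τ
      -- Three copies of `v` in `s` would all lie in `w`, which contains only `k` of them.
      ... | yes refl = <⇒≱ (subst (3 ≤_) (occurrences-insertion k r r<v i)
            (subst (_≤ length (occurrences {u} w)) (cong length (filter-all (_≟ v) (refl ∷ refl ∷ refl ∷ [])))
              (length-mono-≤ (filter⁺ (_≟ v) (_≟ v) (λ { refl q → q })
                (subst (_ ⊆_) e (⊆-below (≤-refl ∷ ≤-refl ∷ ≤-refl ∷ []) τ)))))) k≤2

    -- The word `w` is recovered from `s` as its letters up to `v`, and `insertion-exists` reads off
    -- the number of copies.
    extends-insertion : ∀ {n m s} → Extends v v (rev r) n m s →
      ∃ λ k → ∃ λ n′ → ∃ λ m′ → k ≤ 2 × n ≡ k + n′ × m ≡ isSuc k + m′ × Placed v r k n′ m′ s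
    extends-insertion {n} {m} {s} (extends e a z bd l d) =
      k , n′ , m′ , k≤2 , n≡ , trans (sym d) (placed-newDist P) , P
      where
      w = below (suc v) s
      wr = rev-reverse w
      w<1+v : All (_< suc v) (reverse w)
      w<1+v = rev-<⁻ (reverse w) (subst (All (_< suc v)) (sym wr) (below-< (suc v) s))
      exists : ∃ λ k → Insertion v k r (rev (reverse w))
      exists = insertion-exists (reverse w) r w<1+v (trans (cong (below v) wr) (trans (below-below v s) e))
      k = proj₁ exists
      i : Insertion v k r w
      i = subst (Insertion v k r) wr (proj₂ exists)
      n′ = length s ∸ length w
      m′ = newDist (suc v) s
      ls : length s ≡ length w + n′
      ls = sym (m+[n∸m]≡n (length-mono-≤ (filter-⊆ (_<? suc v) s)))
      P : Placed v r k n′ m′ s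
      P = w , i , extends refl a (λ v<u → z (<⇒≤ v<u)) bd ls refl
      k≤2 : k ≤ 2
      k≤2 with k | i
      ... | 0 | _ = z≤n
      ... | 1 | _ = s≤s z≤n
      ... | 2 | _ = ≤-refl
      -- All inserted copies occur in `s`, so a third one would complete a 000.
      ... | suc (suc (suc k)) | i′ = contradiction
        (⊆-trans (refl ∷ refl ∷ refl ∷ minimum _)
          (⊆-trans (replicate-⊆-insertion (3 + k) r i′) (filter-⊆ (_<? suc v) s)))
        (z ≤-refl)
      n≡ : n ≡ k + n′
      n≡ = +-cancelˡ-≡ (length r) n (k + n′) (begin
        length r + n          ≡⟨ cong (_+ n) (length-rev r) ⟨
        length (rev r) + n    ≡⟨ l ⟨
        length s              ≡⟨ ls ⟩
        length w + n′         ≡⟨ cong (_+ n′) (length-insertion k r i) ⟩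
        k + length r + n′     ≡⟨ cong (_+ n′) (+-comm k (length r)) ⟩
        length r + k + n′     ≡⟨ +-assoc (length r) k n′ ⟩
        length r + (k + n′)   ∎)
        where open ≡-Reasoning

  -- The counting recurrences.

  δ : ℕ → ℕ → ℕ
  δ zero zero = 1
  δ _    _    = 0

  -- H n d m counts the completions by n letters with m distinct values when the run has d letters left; in Z, S
  -- and W the next value v is used 0, 1 and 2 times, and in S and W the n, m count only the letters above v.
  -- The recursions of S and W distinguish whether the letters up to v end with v or with the last letter of
  -- the run, which is then the last letter of the whole word.
  H Z R S W : ℕ → ℕ → ℕ → ℕ
  H n d m = Z n d m + R n d m

  Z n zero    m = δ n m
  Z n (suc d) m = H n d m

  R zero          d m       = 0
  R (suc n)       d zero    = 0
  R (suc zero)    d (suc m) = S 0 d m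
  R (suc (suc n)) d (suc m) = S (suc n) d m + W n d m

  S n zero    m = Z n 1 m
  S n (suc d) m = S n d m + Z n (suc (suc d)) m

  W n zero    m = Z n 2 m
  W n (suc d) m = W n d m + (Z n (suc (suc (suc d))) m + S n d m)

  extends-det : ∀ {b v w w′ n n′ m m′ s} → Extends b v w n m s → Extends b v w′ n′ m′ s → w ≡ w′
  extends-det x y = trans (sym (Extends.below≡ x)) (Extends.below≡ y)

  -- The finished words that use `v`, once or twice. The clauses follow those of `R`.
  Rest : ℕ → List ℕ → ℕ → ℕ → List ℕ → Set
  Rest v r zero          m       s = ⊥
  Rest v r (suc n)       zero    s = ⊥
  Rest v r (suc zero)    (suc m) s = Placed v r 1 0 m s
  Rest v r (suc (suc n)) (suc m) s = Placed v r 1 (suc n) m s ⊎ Placed v r 2 n m s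

  module _ {v : ℕ} {r : List ℕ} (r<v : All (_< v) r) where
    extends⇒rest : ∀ {n m s} → Extends v v (rev r) n m s → Extends v (suc v) (rev r) n m s ⊎ Rest v r n m s
    extends⇒rest x with extends-insertion r<v x
    ... | 0 , n , m , _ , refl , refl , (_ , refl , y)     = inj₁ y
    ... | 1 , zero  , m , _ , refl , refl , p = inj₂ p
    ... | 1 , suc n , m , _ , refl , refl , p = inj₂ (inj₁ p)
    ... | 2 , n , m , _ , refl , refl , p = inj₂ (inj₂ p)
    ... | suc (suc (suc _)) , _ , _ , s≤s (s≤s ()) , _

    rest⇒extends : ∀ n m {s} → Rest v r n m s → Extends v v (rev r) n m s
    rest⇒extends (suc zero)    (suc m) p        = extend-insertion r<v (s≤s z≤n) p
    rest⇒extends (suc (suc n)) (suc m) (inj₁ p) = extend-insertion r<v (s≤s z≤n) p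
    rest⇒extends (suc (suc n)) (suc m) (inj₂ p) = extend-insertion r<v ≤-refl p

    -- The letters of `s` up to `v` determine their number, which is `k + length r`.
    placed-disjoint : ∀ {k l n n′ m m′ s} → k ≢ l → Placed v r k n m s → ¬ Placed v r l n′ m′ s
    placed-disjoint {k} {l} k≢l (w , i , x) (w′ , j , y) = k≢l (+-cancelʳ-≡ (length r) k l
      (trans (sym (length-insertion k r i)) (trans
        (cong length (trans (sym (Extends.below≡ x)) (Extends.below≡ y))) (length-insertion l r j))))

    rest-disjoint : ∀ n m {s} → Extends v (suc v) (rev r) n m s → ¬ Rest v r n m s
    rest-disjoint (suc zero)    (suc m) x p        = placed-disjoint {0} {1} (λ ()) (_ , refl , x) p
    rest-disjoint (suc (suc n)) (suc m) x (inj₁ p) = placed-disjoint {0} {1} (λ ()) (_ , refl , x) p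
    rest-disjoint (suc (suc n)) (suc m) x (inj₂ p) = placed-disjoint {0} {2} (λ ()) (_ , refl , x) p

  -- Appending `f` is a bijection by `tail⁺` and `tail⁻`, because a descent in `w ∷ʳ f` forces every
  -- completion to end in `f`. The predicate `I` lets `w` range over all insertions of one kind.
  counted-tail : ∀ {v f n m c} {I : List ℕ → Set} →
    (∀ {w} → I w → All (_< suc v) (w ∷ʳ f) × Avoids102 (w ∷ʳ f) × ∃ λ x → ∃ λ y → x ∷ y ∷ [] ⊆ w ∷ʳ f × y < x) →
    Counted (λ t → ∃ λ w → I w × Extends v (suc v) w n m t) c →
    Counted (λ s → ∃ λ w → I w × Extends v (suc v) (w ∷ʳ f) n m s) c
  counted-tail {v} {f} {n} {m} {I = I} good C = counted-⇔
    (λ { (t , refl , w , i , x) → let (w<1+v , av , _) = good i in w , i , tail⁺ ≤-refl w<1+v av x })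
    (λ { (w , i , x) → let (w<1+v , _ , _ , _ , τ , y<x) = good i ; (t , e , x′) = tail⁻ w<1+v τ y<x x in
           t , e , w , i , x′ })
    (counted-map {P = λ t → ∃ λ w → I w × Extends v (suc v) w n m t}
      (_∷ʳ f) (λ {x} {y} e → ∷ʳ-injectiveˡ x y e) C)

  sorted-∷ʳ : ∀ {w v} → Sorted w → All (_≤ v) w → Sorted (w ∷ʳ v)
  sorted-∷ʳ {w} sorted w≤v {x} τ with ⊆-∷ʳ⁻ w τ
  ... | inj₁ σ = sorted σ
  ... | inj₂ (bs , e , σ) with refl , refl ← ∷ʳ-injective [ x ] bs e = All.head (All-resp-⊆ σ w≤v)

  sorted-rev : ∀ {x} r → Sorted (rev (x ∷ r)) → Sorted (rev r)
  sorted-rev {x} r sorted τ = sorted (⊆-∷ʳ x τ)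

  -- The five statements follow the recursion of the counts: placing a value lowers `n` even if it
  -- lengthens the run, and freezing a letter lowers `d`. The run enters the count only through its
  -- length.
  counted-H : ∀ n d m v w → length w ≡ d → Sorted w → All (_< v) w → Counted (Extends v v w n m) (H n d m)
  counted-Z : ∀ n d m v w → length w ≡ d → Sorted w → All (_< suc v) w →
              Counted (Extends v (suc v) w n m) (Z n d m)
  counted-R : ∀ n d m v r → length r ≡ d → Sorted (rev r) → All (_< v) r → Counted (Rest v r n m) (R n d m)
  counted-S : ∀ n d m v r → length r ≡ d → Sorted (rev r) → All (_< v) r → Counted (Placed v r 1 n m) (S n d m)
  counted-W : ∀ n d m v r → length r ≡ d → Sorted (rev r) → All (_< v) r → Counted (Placed v r 2 n m) (W n d m)

  counted-H n d m v w l sorted w<v = subst (λ w → Counted (Extends v v w n m) (H n d m)) wr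
    (counted-⇔ [ (λ x → extend-insertion r<v z≤n (_ , refl , x)) , rest⇒extends r<v n m ]′ (extends⇒rest r<v)
      (counted-⊎ (rest-disjoint r<v n m)
        (counted-Z n d m v (rev r) (trans (cong length wr) l) sorted′
          (subst (All (_< suc v)) (sym wr) (All.map m<n⇒m<1+n w<v)))
        (counted-R n d m v r (trans (length-reverse w) l) sorted′ r<v)))
    where
    r  = reverse w
    wr = rev-reverse w
    sorted′ : Sorted (rev r)
    sorted′ = subst Sorted (sym wr) sorted
    r<v : All (_< v) r
    r<v = rev-<⁻ r (subst (All (_< v)) (sym wr) w<v)

  counted-Z zero    zero    zero    v [] l sorted w<1+v =
    counted-⇔ (λ { refl → freeze-[]⁺ }) (λ x → proj₁ (freeze-[]⁻ x)) counted-[ [] ]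
  counted-Z zero    zero    (suc m) v [] l sorted w<1+v = counted-∅ (λ x → 1+n≢0 (proj₂ (proj₂ (freeze-[]⁻ x))))
  counted-Z (suc n) zero    m       v [] l sorted w<1+v = counted-∅ (λ x → 1+n≢0 (proj₁ (proj₂ (freeze-[]⁻ x))))
  counted-Z n       (suc d) m       v (f ∷ w) l sorted (f<1+v ∷ w<1+v) = counted-⇔
    (λ { (t , refl , x) → freeze⁺ f<1+v sorted x })
    (freeze⁻ f<1+v)
    (counted-map (f ∷_) ∷-injectiveʳ
      (counted-H n d m (suc v) w (suc-injective l) (λ τ → sorted (f skip τ)) w<1+v))

  counted-R zero          d m       v r l sorted r<v = counted-∅ (λ ())
  counted-R (suc zero)    d zero    v r l sorted r<v = counted-∅ (λ ())
  counted-R (suc (suc n)) d zero    v r l sorted r<v = counted-∅ (λ ())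
  counted-R (suc zero)    d (suc m) v r l sorted r<v = counted-S 0 d m v r l sorted r<v
  counted-R (suc (suc n)) d (suc m) v r l sorted r<v = counted-⊎ (placed-disjoint r<v {1} {2} (λ ()))
    (counted-S (suc n) d m v r l sorted r<v)
    (counted-W n d m v r l sorted r<v)

  counted-S n zero m v [] l sorted r<v = counted-⇔
    (λ x → [ v ] , ([] , refl , refl) , x)
    (λ { (_ , ([] , refl , refl) , x) → x })
    (counted-Z n 1 m v [ v ] refl (λ { (_ skip ()) ; (refl ∷ ()) }) (≤-refl ∷ []))
  -- If `v` comes last, the letters up to `v` stay sorted and form a run of length d + 2. Otherwise
  -- `v` precedes `f`, and this descent makes `f` the last letter of the whole word.
  counted-S n (suc d) m v (f ∷ r) l sorted (f<v ∷ r<v) = counted-⇔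
    [ (λ { (w , i , x) → w ∷ʳ f , inj₂ (w , refl , i) , x })
    , (λ x → rev (f ∷ r) ∷ʳ v , inj₁ (_ , refl , refl) , x) ]′
    (λ { (_ , inj₁ (_ , refl , refl) , x) → inj₂ x ; (_ , inj₂ (w , refl , i) , x) → inj₁ (w , i , x) })
    (counted-⊎
      (λ { (w , i , x) y → <⇒≢ f<v (∷ʳ-injectiveʳ w _ (extends-det x y)) })
      (counted-tail
        (λ {w} i → let I = inj₂ (w , refl , i) ; w<1+v = insertion-≤ 1 (f ∷ r) (f<v ∷ r<v) I in
          w<1+v , avoids102 (subst Sorted (sym (below-insertion 1 (f ∷ r) (f<v ∷ r<v) I)) sorted) w<1+v
          , v , f , ++⁺ (from∈ (∈-insertion 0 r i)) ⊆-refl , f<v)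
        (counted-S n d m v r (suc-injective l) (sorted-rev r sorted) r<v))
      (counted-Z n (2 + d) m v (rev (f ∷ r) ∷ʳ v)
        (trans (length-∷ʳ (rev (f ∷ r)) v) (cong suc (trans (length-rev (f ∷ r)) l)))
        (sorted-∷ʳ sorted (All.map <⇒≤ fr<v)) (Allₚ.∷ʳ⁺ (All.map m<n⇒m<1+n fr<v) ≤-refl)))
    where
    fr<v : All (_< v) (rev (f ∷ r))
    fr<v = rev-<⁺ (f ∷ r) (f<v ∷ r<v)

  counted-W n zero m v [] l sorted r<v = counted-⇔
    (λ x → v ∷ [ v ] , ([ v ] , refl , [] , refl , refl) , x)
    (λ { (_ , (_ , refl , [] , refl , refl) , x) → x })
    (counted-Z n 2 m v (v ∷ [ v ]) refl
      (λ { (refl ∷ refl ∷ []) → ≤-refl ; (refl ∷ (_ skip ())) ; (_ skip (_ skip ())) ; (_ skip (refl ∷ ())) })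
      (≤-refl ∷ ≤-refl ∷ []))
  counted-W n (suc d) m v (f ∷ r) l sorted (f<v ∷ r<v) = counted-⇔
    [ (λ { (w , i , x) → w ∷ʳ f , inj₂ (w , refl , i) , x })
    , [ (λ x → rev (f ∷ r) ∷ʳ v ∷ʳ v , inj₁ (_ , refl , inj₁ (_ , refl , refl)) , x)
      , (λ { (_ , (w , refl , i) , x) → w ∷ʳ f ∷ʳ v , inj₁ (_ , refl , inj₂ (w , refl , i)) , x }) ]′ ]′
    (λ { (_ , inj₁ (_ , refl , inj₁ (_ , refl , refl)) , x) → inj₂ (inj₁ x)
       ; (_ , inj₁ (_ , refl , inj₂ (w , refl , i)) , x) → inj₂ (inj₂ (_ , (w , refl , i) , x))
       ; (_ , inj₂ (w , refl , i) , x) → inj₁ (w , i , x) })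
    (counted-⊎
      (λ { (w , i , x) (inj₁ y)           → <⇒≢ f<v (∷ʳ-injectiveʳ w _ (extends-det x y))
         ; (w , i , x) (inj₂ (_ , _ , y)) → <⇒≢ f<v (∷ʳ-injectiveʳ w _ (extends-det x y)) })
      (counted-tail
        (λ {w} i → good 2 (inj₂ (w , refl , i)) (++⁺ (from∈ (∈-insertion 1 r i)) ⊆-refl))
        (counted-W n d m v r (suc-injective l) (sorted-rev r sorted) r<v))
      (counted-⊎
        (λ { x (_ , (w , refl , _) , y) →
          <⇒≢ f<v (∷ʳ-injectiveʳ w _ (∷ʳ-injectiveˡ (w ∷ʳ f) _ (extends-det y x))) })
        (counted-Z n (3 + d) m v (rev (f ∷ r) ∷ʳ v ∷ʳ v)
          (trans (length-∷ʳ (rev (f ∷ r) ∷ʳ v) v) (cong suc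
            (trans (length-∷ʳ (rev (f ∷ r)) v) (cong suc (trans (length-rev (f ∷ r)) l)))))
          (sorted-∷ʳ (sorted-∷ʳ sorted (All.map <⇒≤ fr<v)) (Allₚ.∷ʳ⁺ (All.map <⇒≤ fr<v) ≤-refl))
          (Allₚ.∷ʳ⁺ (Allₚ.∷ʳ⁺ (All.map m<n⇒m<1+n fr<v) ≤-refl) ≤-refl))
        -- One copy of `v` precedes `f` and the other follows it. The descent from `v` to `f` makes
        -- both the trailing `v` and the `f` before it final, so they are stripped one after the
        -- other and one copy of `v` in `rev r` remains.
        (counted-tail {I = λ w → ∃ λ w₀ → w ≡ w₀ ∷ʳ f × Insertion v 1 r w₀}
          (λ { (w , refl , i) → good 2 (inj₁ (_ , refl , inj₂ (w , refl , i)))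
                 (⊆-∷ʳ v (++⁺ (from∈ (∈-insertion 0 r i)) ⊆-refl)) })
          (counted-⇔
            (λ { (w , i , x) → w ∷ʳ f , (w , refl , i) , x })
            (λ { (_ , (w , refl , i) , x) → w , i , x })
            (counted-tail
              (λ {w} i → good 1 (inj₂ (w , refl , i)) (++⁺ (from∈ (∈-insertion 0 r i)) ⊆-refl))
              (counted-S n d m v r (suc-injective l) (sorted-rev r sorted) r<v))))))
    where
    fr<v : All (_< v) (rev (f ∷ r))
    fr<v = rev-<⁺ (f ∷ r) (f<v ∷ r<v)
    good : ∀ k {w} → Insertion v k (f ∷ r) w → v ∷ f ∷ [] ⊆ w →
           All (_< suc v) w × Avoids102 w × ∃ λ x → ∃ λ y → x ∷ y ∷ [] ⊆ w × y < x
    good k {w} i τ = w<1+v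
                   , avoids102 (subst Sorted (sym (below-insertion k (f ∷ r) (f<v ∷ r<v) i)) sorted) w<1+v
                   , v , f , τ , f<v
      where
      w<1+v : All (_< suc v) w
      w<1+v = insertion-≤ k (f ∷ r) (f<v ∷ r<v) i

  -- Inversion sequences as bounded words.

  concatMap-map : ∀ {A B C : Set} (f : A → B → C) xs ys →
                  concatMap (λ x → map (f x) ys) xs ≡ cartesianProductWith f xs ys
  concatMap-map f []       ys = refl
  concatMap-map f (x ∷ xs) ys = cong (map (f x) ys ++_) (concatMap-map f xs ys)

  invSeqs-suc : ∀ n → invSeqs (suc n) ≡ cartesianProductWith Vec._∷ʳ_ (invSeqs n) (upTo (suc n))
  invSeqs-suc n = concatMap-map Vec._∷ʳ_ (invSeqs n) (upTo (suc n))

  invSeqs-unique : ∀ n → Unique (invSeqs n)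
  invSeqs-unique zero    = [] ∷ []
  invSeqs-unique (suc n) = subst Unique (sym (invSeqs-suc n))
    (Unique.cartesianProductWith⁺ Vec._∷ʳ_ (Vecₚ.∷ʳ-injective _ _) (invSeqs-unique n) (Unique.upTo⁺ (suc n)))

  invSeqs-sound : ∀ n {e} → e ∈ invSeqs n → Bounded 0 (toList e)
  invSeqs-sound zero    (here refl) = tt
  invSeqs-sound (suc n) e∈
    with e , v , e∈′ , v∈ , refl ← ∈-cartesianProductWith⁻ Vec._∷ʳ_ (invSeqs n) (upTo (suc n))
           (subst (_ ∈_) (invSeqs-suc n) e∈) =
    subst (Bounded 0) (sym (Vecₚ.toList-∷ʳ v e)) (Bounded-∷ʳ⁺ (toList e) (invSeqs-sound n e∈′)
      (subst (v ≤_) (sym (Vecₚ.length-toList e)) (≤-pred (∈-upTo⁻ v∈))))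

  invSeqs-complete : ∀ n {e} → Bounded 0 (toList e) → e ∈ invSeqs n
  invSeqs-complete zero    {[]} _ = here refl
  invSeqs-complete (suc n) {e} bd with e′ , v , refl ← Vec.initLast e =
    subst (e′ Vec.∷ʳ v ∈_) (sym (invSeqs-suc n)) (∈-cartesianProductWith⁺ Vec._∷ʳ_
      (invSeqs-complete n (proj₁ bd′)) (∈-upTo⁺ (s≤s (subst (v ≤_) (Vecₚ.length-toList e′) (proj₂ bd′)))))
    where
    bd′ : Bounded 0 (toList e′) × v ≤ length (toList e′)
    bd′ = Bounded-∷ʳ⁻ (toList e′) (subst (Bounded 0) (Vecₚ.toList-∷ʳ v e′) bd)

  -- Patterns at increasing indices and sublists.

  lookup-⊆₁ : ∀ {n} (e : Vec ℕ n) i → lookup e i ∷ [] ⊆ toList e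
  lookup-⊆₁ (x ∷ e) zero    = refl ∷ minimum _
  lookup-⊆₁ (x ∷ e) (suc i) = x skip lookup-⊆₁ e i

  lookup-⊆₂ : ∀ {n} (e : Vec ℕ n) {i j} → i Fin.< j → lookup e i ∷ lookup e j ∷ [] ⊆ toList e
  lookup-⊆₂ (x ∷ e) {zero}  {suc j} _         = refl ∷ lookup-⊆₁ e j
  lookup-⊆₂ (x ∷ e) {suc i} {suc j} (s≤s i<j) = x skip lookup-⊆₂ e i<j

  lookup-⊆₃ : ∀ {n} (e : Vec ℕ n) {i j k} → i Fin.< j → j Fin.< k →
              lookup e i ∷ lookup e j ∷ lookup e k ∷ [] ⊆ toList e
  lookup-⊆₃ (x ∷ e) {zero}  {suc j} {suc k} _         (s≤s j<k) = refl ∷ lookup-⊆₂ e j<k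
  lookup-⊆₃ (x ∷ e) {suc i} {suc j} {suc k} (s≤s i<j) (s≤s j<k) = x skip lookup-⊆₃ e i<j j<k

  index₁ : ∀ {n x} (e : Vec ℕ n) → x ∷ [] ⊆ toList e → ∃ λ i → lookup e i ≡ x
  index₁ (x ∷ e) (refl ∷ τ) = zero , refl
  index₁ (x ∷ e) (_ skip τ) with i , p ← index₁ e τ = suc i , p

  index₂ : ∀ {n x y} (e : Vec ℕ n) → x ∷ y ∷ [] ⊆ toList e →
           ∃ λ i → ∃ λ j → i Fin.< j × lookup e i ≡ x × lookup e j ≡ y
  index₂ (x ∷ e) (refl ∷ τ) with j , q ← index₁ e τ = zero , suc j , z<s , refl , q
  index₂ (x ∷ e) (_ skip τ) with i , j , i<j , p , q ← index₂ e τ = suc i , suc j , s≤s i<j , p , q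

  index₃ : ∀ {n x y z} (e : Vec ℕ n) → x ∷ y ∷ z ∷ [] ⊆ toList e →
           ∃ λ i → ∃ λ j → ∃ λ k → (i Fin.< j × j Fin.< k) × lookup e i ≡ x × lookup e j ≡ y × lookup e k ≡ z
  index₃ (x ∷ e) (refl ∷ τ) with j , k , j<k , q , r ← index₂ e τ =
    zero , suc j , suc k , (z<s , s≤s j<k) , refl , q , r
  index₃ (x ∷ e) (_ skip τ) with i , j , k , (i<j , j<k) , p , q , r ← index₃ e τ =
    suc i , suc j , suc k , (s≤s i<j , s≤s j<k) , p , q , r

  dist≡newDist : ∀ {n} (e : Vec ℕ n) → dist e ≡ newDist 0 (toList e)
  dist≡newDist e = cong length (sym (filter-all (0 ≤?_)
    (All.universal (λ _ → z≤n) (deduplicate _≟_ (toList e)))))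

  below-zero : ∀ s → below 0 s ≡ []
  below-zero []      = refl
  below-zero (x ∷ s) = below-zero s

  avoids⇒extends : ∀ {n m} (e : Vec ℕ n) → Bounded 0 (toList e) → Avoids102-000 e → dist e ≡ m →
                   Extends 0 0 [] n m (toList e)
  avoids⇒extends e bd (¬102 , ¬000) d = extends (below-zero (toList e))
    (λ τ y<x x<z → let (i , j , k , ijk , p , q , r) = index₃ e τ in
       ¬102 (i , j , k , ijk , subst₂ _<_ (sym q) (sym p) y<x , subst₂ _<_ (sym p) (sym r) x<z))
    (λ _ τ → let (i , j , k , ijk , p , q , r) = index₃ e τ in
       ¬000 (i , j , k , ijk , trans p (sym q) , trans q (sym r)))
    bd (Vecₚ.length-toList e) (trans (sym (dist≡newDist e)) d)

  extends⇒avoids : ∀ {n m} (e : Vec ℕ n) → Extends 0 0 [] n m (toList e) → Avoids102-000 e × dist e ≡ m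
  extends⇒avoids e (extends _ a z _ _ d) =
    ( (λ (i , j , k , (i<j , j<k) , y<x , x<z) → a (lookup-⊆₃ e i<j j<k) y<x x<z)
    , (λ (i , j , k , (i<j , j<k) , p , q) → z z≤n
         (subst₂ (λ x y → x ∷ lookup e j ∷ y ∷ [] ⊆ toList e) p (sym q) (lookup-⊆₃ e i<j j<k))) )
    , trans (dist≡newDist e) d

  toList-surjective : ∀ {n} (s : List ℕ) → length s ≡ n → ∃ λ (e : Vec ℕ n) → s ≡ toList e
  toList-surjective s refl = fromList s , sym (Vecₚ.toList∘fromList s)

  toList-injective : ∀ {n} {e e′ : Vec ℕ n} → toList e ≡ toList e′ → e ≡ e′
  toList-injective {e = e} {e′} p = trans (sym (Vecₚ.cast-is-id refl e)) (Vecₚ.toList-injective refl e e′ p)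

  count≡H : ∀ n m → count n m ≡ H n 0 m
  count≡H n m = counted-det
    (counted-⇔
      (λ { (e , refl , e∈ , av , d) → avoids⇒extends e (invSeqs-sound n e∈) av d })
      (λ {s} x → let (e , p) = toList-surjective s (Extends.length≡ x) in
        e , p , invSeqs-complete n (subst (Bounded 0) p (Extends.bounded x))
          , extends⇒avoids e (subst (Extends 0 0 [] n m) p x))
      (counted-map toList toList-injective (counted _ (Unique.filter⁺ P? (invSeqs-unique n))
        (∈-filter⁻ P?) (λ (e∈ , p) → ∈-filter⁺ P? e∈ p) refl)))
    -- At the start no value is placed: the threshold and the shift of the bound are 0 and the run
    -- is empty.
    (counted-H n 0 m 0 [] refl (λ ()) [])
    where
    P? : (e : Vec ℕ n) → _
    P? e = avoids? e ×-dec (dist e ≟ m)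

-- Generating functions of the counts.

open GeneratingFunctions
open InversionSequences using (H; R; S; W; δ; count≡H)
open import Data.Integer using (_+_; _*_)

Hˢ Sˢ Wˢ : ℕ → Series
Hˢ d n m = + H n d m
Sˢ d n m = + S n d m
Wˢ d n m = + W n d m

+δ : ∀ n m → + δ n m ≡ X.const (Y.const (+ 1)) n m
+δ zero    zero    = refl
+δ zero    (suc m) = refl
+δ (suc n) m       = refl

-- A used value contributes y for itself and one x per copy, hence the further x before `Wˢ d`. The
-- clauses of `R` are the resulting shifts of coefficients.
+R : ∀ d n m → + R n d m ≡ xy (Sˢ d +ˢ X.var *ˢ Wˢ d) n m
+R d zero m = sym (xy-zeroˡ (Sˢ d +ˢ X.var *ˢ Wˢ d) m)
+R d (suc zero) zero = sym (xy-zeroʳ (Sˢ d +ˢ X.var *ˢ Wˢ d) 0)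
+R d (suc (suc n)) zero = sym (xy-zeroʳ (Sˢ d +ˢ X.var *ˢ Wˢ d) (suc n))
+R d (suc zero) (suc m) = sym (trans (xy-suc (Sˢ d +ˢ X.var *ˢ Wˢ d) 0 m)
  (trans (cong (λ a → + S 0 d m + a) (X.var-⋆-zero (Wˢ d) m)) (ℤ.+-identityʳ _)))
+R d (suc (suc n)) (suc m) = sym (trans (xy-suc (Sˢ d +ˢ X.var *ˢ Wˢ d) (suc n) m)
  (cong (λ a → + S (suc n) d m + a) (X.var-⋆-suc (Wˢ d) n m)))

theorem4p1 : (B : Series) → SatisfiesB B →
    (n m : ℕ) → n ≥ 1 → m ≥ 1 →
    + count n m ≡ B (suc n) m + ∑< n (λ i → ∑≤ m (λ ℓ → B (suc i) ℓ * B (n ∸ suc i) (m ∸ ℓ)))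
theorem4p1 B satB (suc n) m _ _ = trans (cong +_ (count≡H (suc n) m))
  (H₀-formula B satB Hˢ Sˢ Wˢ
    -- Since `Z n (suc d) m` unfolds to `H n d m` and sums of nonnegative integers compute, the
    -- recurrences of `S` and the start of `W` hold by computation.
    (λ _ _ → refl)
    (λ _ _ _ → refl)
    (λ _ _ → refl)
    (λ d n m → sym (ℤ.+-assoc (Wˢ d n m) (Hˢ (suc (suc d)) n m) (Sˢ d n m)))
    (λ n m → cong₂ _+_ (+δ n m) (+R 0 n m))
    (λ d n m → cong (λ a → + H n d m + a) (+R (suc d) n m))
    n m)
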